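{- Let $k\in\mathbb{N}$. Every edge-coloured graph $G$ on $n \ge 7k/2+2$ vertices with $\delta^c(G) \geq k$ contains a rainbow matching of size $k$.
   Context: Graphs are simple (no loops or multiple edges). An edge-coloured graph is a graph in which each edge is assigned a colour (not necessarily properly). A subgraph is rainbow if all its edges have distinct colours. For a vertex $v$, the colour degree $d^c(v)$ is the number of distinct colours on the edges incident with $v$; $\delta^c(G)=\min_{v\in V(G)} d^c(v)$ is the minimum colour degree. -}

module Defs where

open import Data.Nat using (ℕ; _≟_)
open import Data.Fin using (Fin)
open import Data.Maybe using (Maybe; just; nothing)
open import Data.List using (List; length; mapMaybe; deduplicate)
open import Data.List using () renaming (allFin to allFinL)
open import Data.Product using (_×_; Σ; ∃; _,_)
open import Relation.Binary.PropositionalEquality using (_≡_; _≢_)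

-- An edge-coloured simple graph on vertex set Fin n, colours drawn from ℕ.
-- col u v ≡ nothing  : u and v are not adjacent
-- col u v ≡ just c   : uv is an edge with colour c
-- Simplicity: symmetric, no loops.  (Colouring need not be proper.)
record ColouredGraph (n : ℕ) : Set where
  field
    col      : Fin n → Fin n → Maybe ℕ
    col-sym  : ∀ u v → col u v ≡ col v u
    col-irr  : ∀ v → col v v ≡ nothing
open ColouredGraph public

incidentColours : ∀ {n} → ColouredGraph n → Fin n → List ℕ
incidentColours G v = mapMaybe (col G v) (allFinL _)

colourDegree : ∀ {n} → ColouredGraph n → Fin n → ℕ
colourDegree G v = length (deduplicate _≟_ (incidentColours G v))

MinColourDegree≥ : ∀ {n} → ColouredGraph n → ℕ → Set
MinColourDegree≥ G k = ∀ v → k Data.Nat.≤ colourDegree G v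

record RainbowMatching {n} (G : ColouredGraph n) (k : ℕ) : Set where
  field
    a b      : Fin k → Fin n
    c        : Fin k → ℕ
    isEdge   : ∀ i → col G (a i) (b i) ≡ just (c i)
    disjAA   : ∀ i j → i ≢ j → a i ≢ a j
    disjBB   : ∀ i j → i ≢ j → b i ≢ b j
    disjAB   : ∀ i j → a i ≢ b j
    rainbow  : ∀ i j → i ≢ j → c i ≢ c j

-- A matching of size k − 1 is augmented. Colours occurring on two disjoint edges (the components of the pool) survive
-- the loss of any one vertex, so an edge of an unused colour at a component, or between free vertices, augments at
-- once. An edge there whose colour is used by a single edge e instead makes the colour of e survive the loss of a
-- vertex as well: it is absorbed, together with e and the components at its ends, into the protected part Z. Such a
-- step loses at most three components per single edge, where a free vertex counts as two components; this keeps the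
-- budget inequality, whose initial value is the bound on n. When no such step is available, the remaining edges of free
-- vertices and components lead to single edges, and single edges are promoted one by one: they can be exchanged along
-- alternating paths that free their second endpoint. Each promotion uses up one free vertex or one component, so by the
-- budget one of the earlier cases has to occur. Components whose two edges are joined by two further edges need
-- separate care: they can pass their colour on and use a joining edge instead.
module Submission where

open import Defs
open import Data.Nat using (ℕ; zero; suc; _+_; _*_; _≤_; _<_; z≤n; s≤s; s≤s⁻¹)
import Data.Nat as ℕ
open import Algebra.Bundles using (CommutativeMonoid)
open import Data.Empty using (⊥; ⊥-elim)
open import Data.Fin using (Fin)
import Data.Fin as Fin
open import Data.List using (List; []; _∷_; _++_; length; map; mapMaybe; deduplicate; allFin; lookup)
open import Data.List.Membership.Propositional using (_∈_; _∉_; lose)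
open import Data.List.Membership.Propositional.Properties
  using (∈-++⁺ˡ; ∈-++⁺ʳ; ∈-++⁻; ∈-∃++; ∈-allFin; ∈-map⁺; ∈-map⁻; ∈-lookup; ∈-deduplicate⁻)
import Data.List.Membership.DecPropositional as DecMembership
open import Data.List.Properties using (length-++; length-map; length-mapMaybe; length-tabulate; map-++; ++-assoc)
open import Data.List.Relation.Binary.Permutation.Propositional
  using (_↭_; ↭-refl; ↭-sym; ↭-trans; ↭-reflexive; ↭⇒↭ₛ)
open import Data.List.Relation.Binary.Permutation.Propositional.Properties
  using (∈-resp-↭; ↭-length; ++⁺; ++⁺ˡ; ++⁺ʳ; shift; drop-∷; map⁺; ++-comm; ++-identityʳ; ++-isCommutativeMonoid)
import Data.List.Relation.Binary.Permutation.Setoid.Properties as Permutationₛ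
open import Data.List.Relation.Unary.All as All using (All; []; _∷_)
open import Data.List.Relation.Unary.All.Properties using (¬Any⇒All¬)
open import Data.List.Relation.Unary.AllPairs using ([]; _∷_)
open import Data.List.Relation.Unary.Any as Any using (here; there; any?)
open import Data.List.Relation.Unary.Unique.Propositional using (Unique)
open import Data.List.Relation.Unary.Unique.Propositional.Properties using (allFin⁺)
open import Data.List.Relation.Unary.Unique.DecPropositional.Properties ℕ._≟_ using (deduplicate-!)
open import Data.Maybe using (Maybe; just; nothing)
open import Data.Maybe.Properties using (just-injective)
open import Data.Nat.Properties
open import Data.Nat.Tactic.RingSolver using (solve-∀)
open import Data.Product using (∃; ∃₂; _×_; _,_; proj₁; proj₂)
open import Data.Sum using (_⊎_; inj₁; inj₂; [_,_]′)
open import Function using (case_of_)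
open import Level using (0ℓ)
open import Relation.Binary.PropositionalEquality
  using (_≡_; _≢_; refl; sym; trans; cong; cong₂; subst; subst₂; setoid)
open import Relation.Nullary using (¬_; Dec; yes; no; ¬?; _×-dec_)
open DecMembership ℕ._≟_ using () renaming (_∈?_ to _∈ℕ?_)

-- Lists up to permutation.

module _ {A : Set} where

  uniq-resp : {xs ys : List A} → xs ↭ ys → Unique xs → Unique ys
  uniq-resp p = Permutationₛ.Unique-resp-↭ (setoid A) (↭⇒↭ₛ p)

  ∈⇒↭ : {x : A} {xs : List A} → x ∈ xs → ∃ λ ys → xs ↭ x ∷ ys
  ∈⇒↭ {x} x∈xs with ∈-∃++ x∈xs
  ... | ys , zs , refl = ys ++ zs , shift x ys zs

  ⊆⇒length≤ : {xs ys : List A} → Unique xs → (∀ {x} → x ∈ xs → x ∈ ys) → length xs ≤ length ys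
  ⊆⇒length≤ [] _ = z≤n
  ⊆⇒length≤ {x ∷ xs} {ys} (x∉ ∷ u) sub with ∈⇒↭ (sub (here refl))
  ... | zs , p = subst (suc (length xs) ≤_) (sym (↭-length p)) (s≤s (⊆⇒length≤ u sub′))
    where
    sub′ : ∀ {y} → y ∈ xs → y ∈ zs
    sub′ y∈ with ∈-resp-↭ p (sub (there y∈))
    ... | here refl = ⊥-elim (All.lookup x∉ y∈ refl)
    ... | there q = q

  uniq-tail : {x : A} {xs : List A} → Unique (x ∷ xs) → Unique xs
  uniq-tail (_ ∷ u) = u

  uniq-prefix : ∀ (xs : List A) {ys} → Unique (xs ++ ys) → Unique xs
  uniq-prefix [] _ = []
  uniq-prefix (x ∷ xs) (x∉ ∷ u) = All.tabulate (λ m → All.lookup x∉ (∈-++⁺ˡ m)) ∷ uniq-prefix xs u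

  uniq-∷ : {x : A} {xs : List A} → x ∉ xs → Unique xs → Unique (x ∷ xs)
  uniq-∷ x∉ u = ¬Any⇒All¬ _ x∉ ∷ u

  -- The monoid solver applied to this structure proves all regroupings of vertex and colour lists
  -- below.
  ++-CM : CommutativeMonoid 0ℓ 0ℓ
  ++-CM = record { isCommutativeMonoid = ++-isCommutativeMonoid {A = A} }

  -- The case `keep` allows robust parts to be put side by side: a lost vertex lies in one part
  -- only, and the other parts lose nothing.
  data Rem (X X′ : List A) : Set where
    keep : X ↭ X′ → Rem X X′
    drop : ∀ v → X ↭ v ∷ X′ → Rem X X′

  remSplit : ∀ X {Y Z : List A} → Rem (X ++ Y) Z →
    (∃ λ X′ → Rem X X′ × X′ ++ Y ↭ Z) ⊎ (∃ λ Y′ → Rem Y Y′ × X ++ Y′ ↭ Z)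
  remSplit X (keep p) = inj₁ (X , keep ↭-refl , p)
  remSplit X {Y} (drop v p) with ∈-++⁻ X (∈-resp-↭ (↭-sym p) (here refl))
  ... | inj₁ v∈X = let X′ , q = ∈⇒↭ v∈X in
    inj₁ (X′ , drop v q , drop-∷ (↭-trans (++⁺ʳ Y (↭-sym q)) p))
  ... | inj₂ v∈Y = let Y′ , q = ∈⇒↭ v∈Y in
    inj₂ (Y′ , drop v q , drop-∷ (↭-trans (↭-sym (shift v X Y′)) (↭-trans (++⁺ˡ X (↭-sym q)) p)))

module Perm {A : Set} where
  open import Algebra.Solver.CommutativeMonoid (++-CM {A}) public
    using (solve; _⊜_; _⊕_; id)

open Perm public

-- Edges and the matchings that vertex sets supply.

module Graph {n : ℕ} (G : ColouredGraph n) where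

  V : Set
  V = Fin n

  record Edge : Set where
    constructor edge
    field
      a b : V
      c : ℕ
      isE : col G a b ≡ just c
  open Edge public

  flip : Edge → Edge
  flip (edge a b c e) = edge b a c (trans (col-sym G b a) e)

  vs : List Edge → List V
  vs [] = []
  vs (e ∷ es) = a e ∷ b e ∷ vs es

  cs : List Edge → List ℕ
  cs = map c

  vs-++ : ∀ xs ys → vs (xs ++ ys) ≡ vs xs ++ vs ys
  vs-++ [] ys = refl
  vs-++ (x ∷ xs) ys = cong (λ z → a x ∷ b x ∷ z) (vs-++ xs ys)

  vs-++↭ : ∀ xs ys → vs (xs ++ ys) ↭ vs xs ++ vs ys
  vs-++↭ xs ys = ↭-reflexive (vs-++ xs ys)

  cs-++↭ : ∀ xs ys → cs (xs ++ ys) ↭ cs xs ++ cs ys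
  cs-++↭ xs ys = ↭-reflexive (map-++ c xs ys)

  vs-↭ : ∀ {xs ys} → xs ↭ ys → vs xs ↭ vs ys
  vs-↭ _↭_.refl = ↭-refl
  vs-↭ (_↭_.prep x p) = ++⁺ˡ (a x ∷ b x ∷ []) (vs-↭ p)
  vs-↭ (_↭_.swap {ys = ys} x y p) = ↭-trans (++⁺ˡ (a x ∷ b x ∷ a y ∷ b y ∷ []) (vs-↭ p))
    (++⁺ʳ (vs ys) (++-comm (a x ∷ b x ∷ []) (a y ∷ b y ∷ [])))
  vs-↭ (_↭_.trans p q) = ↭-trans (vs-↭ p) (vs-↭ q)

  length-vs : ∀ xs → length (vs xs) ≡ length xs + length xs
  length-vs [] = refl
  length-vs (x ∷ xs) = cong suc (trans (cong suc (length-vs xs)) (sym (+-suc (length xs) (length xs))))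

  infix 3 _⊩_

  -- `X ⊩ K`: the vertices in `X` carry a matching whose list of colours is `K`. Both lists are read as multisets, so that
  -- disjointness and rainbowness only have to be known for the full lists of vertices and colours.
  record _⊩_ (X : List V) (K : List ℕ) : Set where
    constructor supply
    field
      es : List Edge
      rest : List V
      verts : X ↭ vs es ++ rest
      cols : cs es ↭ K

  ⊩-resp : ∀ {X X′ K K′} → X ↭ X′ → K ↭ K′ → X ⊩ K → X′ ⊩ K′
  ⊩-resp p q (supply es rest v k) = supply es rest (↭-trans (↭-sym p) v) (↭-trans k q)

  ⊩-++ : ∀ {X Y K L} → X ⊩ K → Y ⊩ L → X ++ Y ⊩ K ++ L
  ⊩-++ (supply es rest v k) (supply es′ rest′ v′ k′) = supply (es ++ es′) (rest ++ rest′)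
    (↭-trans (++⁺ v v′) (↭-trans
      (solve 4 (λ a b c d → (a ⊕ b) ⊕ (c ⊕ d) ⊜ (a ⊕ c) ⊕ (b ⊕ d)) ↭-refl (vs es) rest (vs es′) rest′)
      (++⁺ʳ (rest ++ rest′) (↭-sym (vs-++↭ es es′)))))
    (↭-trans (cs-++↭ es es′) (++⁺ k k′))

  ⊩-[] : ∀ {X} → X ⊩ []
  ⊩-[] {X} = supply [] X ↭-refl ↭-refl

  ⊩-weakenˡ : ∀ Y {X K} → X ⊩ K → Y ++ X ⊩ K
  ⊩-weakenˡ Y s = ⊩-++ (⊩-[] {Y}) s

  ⊩-edges : ∀ E → vs E ⊩ cs E
  ⊩-edges E = supply E [] (solve 1 (λ a → a ⊜ a ⊕ id) ↭-refl (vs E)) ↭-refl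

  ⊩-∷ : ∀ {u v c X K} → col G u v ≡ just c → X ⊩ K → u ∷ v ∷ X ⊩ c ∷ K
  ⊩-∷ e s = ⊩-++ (⊩-edges (edge _ _ _ e ∷ [])) s

  -- Robust parts.

  Robust : List V → List ℕ → Set
  Robust X K = ∀ {X′} → Rem X X′ → X′ ⊩ K

  -- The vertex lost on either side is one that a new edge takes away. Two separate sides make room
  -- for an edge with one end in each.
  Robust₂ : List V → List V → List ℕ → Set
  Robust₂ X Y K = ∀ {X′ Y′} → Rem X X′ → Rem Y Y′ → X′ ++ Y′ ⊩ K

  robust-resp : ∀ {X X′ K K′} → X ↭ X′ → K ↭ K′ → Robust X K → Robust X′ K′
  robust-resp p q r (keep s) = ⊩-resp ↭-refl q (r (keep (↭-trans p s)))
  robust-resp p q r (drop v s) = ⊩-resp ↭-refl q (r (drop v (↭-trans p s)))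

  join : ∀ {X Y K} → Robust₂ X Y K → Robust (X ++ Y) K
  join {X} r m with remSplit X m
  ... | inj₁ (X′ , m′ , p) = ⊩-resp p ↭-refl (r m′ (keep ↭-refl))
  ... | inj₂ (Y′ , m′ , p) = ⊩-resp p ↭-refl (r (keep ↭-refl) m′)

  unjoin : ∀ {X K} → Robust X K → Robust₂ X [] K
  unjoin r {X′ = X′} m (keep p) = ⊩-resp (↭-trans (↭-sym (++-identityʳ X′)) (++⁺ˡ X′ p)) ↭-refl (r m)
  unjoin r m (drop v p) with ↭-length p
  ... | ()

  robust-++ : ∀ {X Y K L} → Robust X K → Robust Y L → Robust (X ++ Y) (K ++ L)
  robust-++ {X} r s m with remSplit X m
  ... | inj₁ (X′ , m′ , p) = ⊩-resp p ↭-refl (⊩-++ (r m′) (s (keep ↭-refl)))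
  ... | inj₂ (Y′ , m′ , p) = ⊩-resp p ↭-refl (⊩-++ (r (keep ↭-refl)) (s m′))

  robust₂-++ : ∀ {X Y Z K L} → Robust Z L → Robust₂ X Y K → Robust₂ (Z ++ X) Y (L ++ K)
  robust₂-++ {X} {Y} {Z} s r {Y′ = Y′} m t with remSplit Z m
  ... | inj₁ (Z′ , m′ , p) = ⊩-resp (↭-trans (↭-reflexive (sym (++-assoc Z′ X Y′))) (++⁺ʳ Y′ p)) ↭-refl (⊩-++
      (s m′) (r (keep ↭-refl) t))
  ... | inj₂ (X′ , m′ , p) = ⊩-resp (↭-trans (↭-reflexive (sym (++-assoc Z X′ Y′))) (++⁺ʳ Y′ p)) ↭-refl (⊩-++
      (s (keep ↭-refl)) (r m′ t))

  robust-[] : ∀ {X} → Robust X []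
  robust-[] _ = ⊩-[]

  -- If a vertex of an edge in `Es` is lost, the colours of `Es` come from `A` instead.
  robust₂-merge : ∀ Es {A Y K} → Robust₂ A Y K →
    (∀ {Y′} → Rem Y Y′ → A ++ Y′ ⊩ cs Es ++ K) → Robust₂ (vs Es ++ A) Y (cs Es ++ K)
  robust₂-merge Es {A} r s {Y′ = Y′} m t with remSplit (vs Es) m
  ... | inj₁ (E′ , m′ , p) = ⊩-resp (↭-trans (↭-reflexive (sym (++-assoc E′ A Y′))) (++⁺ʳ Y′ p)) ↭-refl
      (⊩-weakenˡ E′ (s t))
  ... | inj₂ (A′ , m′ , p) = ⊩-resp (↭-trans (↭-reflexive (sym (++-assoc (vs Es) A′ Y′))) (++⁺ʳ Y′ p)) ↭-refl
      (⊩-++ (⊩-edges Es) (r m′ t))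

  -- Components.

  -- Two edges of one colour. They are disjoint because components only occur inside a partition of the vertices.
  record Comp : Set where
    constructor comp
    field
      e₁ e₂ : Edge
      same : c e₁ ≡ c e₂
  open Comp public

  idx : Comp → ℕ
  idx D = c (e₁ D)

  vc : Comp → List V
  vc D = vs (e₁ D ∷ e₂ D ∷ [])

  vp : List Comp → List V
  vp [] = []
  vp (D ∷ Ds) = vc D ++ vp Ds

  ip : List Comp → List ℕ
  ip = map idx

  vp-++ : ∀ xs ys → vp (xs ++ ys) ↭ vp xs ++ vp ys
  vp-++ [] ys = ↭-refl
  vp-++ (x ∷ xs) ys = ++⁺ˡ (vc x) (vp-++ xs ys)

  ip-++ : ∀ xs ys → ip (xs ++ ys) ↭ ip xs ++ ip ys
  ip-++ xs ys = ↭-reflexive (map-++ idx xs ys)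

  vp-↭ : ∀ {xs ys} → xs ↭ ys → vp xs ↭ vp ys
  vp-↭ _↭_.refl = ↭-refl
  vp-↭ (_↭_.prep x p) = ++⁺ˡ (vc x) (vp-↭ p)
  vp-↭ (_↭_.swap {ys = ys} x y p) = ↭-trans (++⁺ˡ (vc x ++ vc y) (vp-↭ p))
    (++⁺ʳ (vp ys) (++-comm (vc x) (vc y)))
  vp-↭ (_↭_.trans p q) = ↭-trans (vp-↭ p) (vp-↭ q)

  -- Whichever of the two edges loses a vertex, the other one is intact and has the same colour.
  robust-edges : ∀ e e′ → c e ≡ c e′ → Robust (vs (e ∷ e′ ∷ [])) (c e ∷ [])
  robust-edges e e′ eq m with remSplit (vs (e ∷ [])) m
  ... | inj₁ (E , _ , p) = ⊩-resp p (↭-reflexive (cong (_∷ []) (sym eq))) (⊩-weakenˡ E (⊩-edges (e′ ∷ [])))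
  ... | inj₂ (E , _ , p) = ⊩-resp p ↭-refl (⊩-++ (⊩-edges (e ∷ [])) (⊩-[] {E}))

  robust-comp : ∀ D → Robust (vc D) (idx D ∷ [])
  robust-comp (comp e e′ eq) = robust-edges e e′ eq

  robust-pool : ∀ Ds → Robust (vp Ds) (ip Ds)
  robust-pool [] = robust-[]
  robust-pool (D ∷ Ds) = robust-++ (robust-comp D) (robust-pool Ds)

  -- Edges of admissible colour.

  ∈-mapMaybe⁻ : ∀ {A B : Set} (f : A → Maybe B) xs {y} → y ∈ mapMaybe f xs → ∃ λ x → x ∈ xs × f x ≡ just y
  ∈-mapMaybe⁻ f (x ∷ xs) y∈ with f x in eq
  ... | nothing = let z , z∈ , e = ∈-mapMaybe⁻ f xs y∈ in z , there z∈ , e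
  ∈-mapMaybe⁻ f (x ∷ xs) (here refl) | just y = x , here refl , eq
  ∈-mapMaybe⁻ f (x ∷ xs) (there y∈) | just _ = let z , z∈ , e = ∈-mapMaybe⁻ f xs y∈ in z , there z∈ , e

  ∈-mapMaybe⁺ : ∀ {A B : Set} (f : A → Maybe B) xs {x y} → x ∈ xs → f x ≡ just y → y ∈ mapMaybe f xs
  ∈-mapMaybe⁺ f (x ∷ xs) (here refl) e with f x
  ∈-mapMaybe⁺ f (x ∷ xs) (here refl) refl | just _ = here refl
  ∈-mapMaybe⁺ f (x ∷ xs) (there x∈) e with f x
  ... | just _ = there (∈-mapMaybe⁺ f xs x∈ e)
  ... | nothing = ∈-mapMaybe⁺ f xs x∈ e

  Sees : V → List ℕ → V → Set
  Sees u badC v = ∃ λ d → col G u v ≡ just d × d ∉ badC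

  sees? : ∀ u badC v → Dec (Sees u badC v)
  sees? u badC v with col G u v
  ... | nothing = no λ ()
  ... | just d with d ∈ℕ? badC
  ... | yes d∈ = no λ { (_ , refl , d∉) → d∉ d∈ }
  ... | no d∉ = yes (d , refl , d∉)

  -- An excluded vertex blocks at most one colour at `u`, so fewer than `k` exclusions of both kinds
  -- together leave a colour over. All uses of the colour degree go through this count.
  find : ∀ {k} u (badC : List ℕ) (badV : List V) → k ≤ colourDegree G u →
    length badC + length badV < k → ∃₂ λ v d → col G u v ≡ just d × d ∉ badC × v ∉ badV
  find {k} u badC badV k≤ lt with any? (λ v → sees? u badC v ×-dec ¬? (v ∈V? badV)) (allFin n)
    where _∈V?_ = DecMembership._∈?_ (Fin._≟_ {n})
  ... | yes p = let v , (d , e , d∉) , v∉ = Any.satisfied p in v , d , e , d∉ , v∉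
  ... | no ¬p = ⊥-elim (<⇒≱ lt (≤-trans k≤ (≤-trans (⊆⇒length≤ (deduplicate-! colours) covered)
      (≤-trans (≤-reflexive (length-++ badC)) (+-monoʳ-≤ (length badC) (length-mapMaybe (col G u) badV))))))
    where
    _∈V?_ = DecMembership._∈?_ (Fin._≟_ {n})
    colours = incidentColours G u
    covered : ∀ {d} → d ∈ deduplicate ℕ._≟_ colours → d ∈ badC ++ mapMaybe (col G u) badV
    covered {d} d∈ with d ∈ℕ? badC
    ... | yes d∈C = ∈-++⁺ˡ d∈C
    ... | no d∉C with ∈-mapMaybe⁻ (col G u) (allFin n) (∈-deduplicate⁻ ℕ._≟_ colours d∈)
    ... | v , v∈ , e with v ∈V? badV
    ... | yes v∈V = ∈-++⁺ʳ badC (∈-mapMaybe⁺ (col G u) badV v∈V e)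
    ... | no v∉V = ⊥-elim (¬p (lose v∈ ((d , e , d∉C) , v∉V)))

-- Configurations and progress.

module Structure {n : ℕ} (G : ColouredGraph n) (k : ℕ) where
  open Graph G public

  Goal : Set
  Goal = ∃ λ K → allFin n ⊩ K × Unique K × length K ≡ k

  -- In the budget a nonempty `Y` is worth as much as the component that was spent on it.
  η : List V → ℕ
  η [] = 0
  η (_ ∷ _) = 1

  -- A rainbow matching of size k − 1: the edges of `S`, one edge of each component of the pool `P`, and a matching
  -- inside `Z ++ Y` with colours `κ`; the vertices of `W` are free. Losing a vertex of a component, or a vertex of `Z`
  -- together with a vertex of `Y`, does not cost a colour.
  record Valid (S : List Edge) (W : List V) (P : List Comp) (Z Y : List V) (κ : List ℕ) : Set where
    field
      part : vs S ++ W ++ vp P ++ Z ++ Y ↭ allFin n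
      uniq : Unique (cs S ++ ip P ++ κ)
      size : suc (length (cs S ++ ip P ++ κ)) ≡ k
      rob : Robust₂ Z Y κ
      -- In all configurations built below, `Y` is empty or consists of the four vertices of one
      -- component.
      small : length Y ≤ 4
      budget : 3 * length S + 11 ≤ length P + 2 * length W + η Y
  open Valid public

  record Config : Set where
    constructor config
    field
      {S} : List Edge
      {W} : List V
      {P} : List Comp
      {Z Y} : List V
      {κ} : List ℕ
      valid : Valid S W P Z Y κ

  -- Progress is lexicographic: after a growth of `κ` the pool may be smaller than before.
  data Step (κ₀ p₀ : ℕ) : Set where
    goal : Goal → Step κ₀ p₀
    κ↑ : (C : Config) → κ₀ < length (Config.κ C) → Step κ₀ p₀
    P↑ : (C : Config) → κ₀ ≡ length (Config.κ C) → p₀ < length (Config.P C) → Step κ₀ p₀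

  -- `S` matters only through its vertices and colours, so its edges may also be reversed, as
  -- `orient` does.
  valid-resp : ∀ {S S′ W W′ P P′ Z Y κ} → vs S ↭ vs S′ → cs S ↭ cs S′ → W ↭ W′ → P ↭ P′ →
    Valid S W P Z Y κ → Valid S′ W′ P′ Z Y κ
  valid-resp {S} {S′} {W} {W′} {P} {P′} {Z} {Y} {κ} pv pc pw pp v = record
    { part = ↭-trans (↭-sym (++⁺ pv (++⁺ pw (++⁺ʳ (Z ++ Y) (vp-↭ pp))))) (part v)
    ; uniq = uniq-resp colours (uniq v)
    ; size = trans (cong suc (sym (↭-length colours))) (size v)
    ; rob = rob v
    ; small = small v
    ; budget = subst₂ _≤_ (cong (λ s → 3 * s + 11) S≡)
        (cong₂ (λ p w → p + 2 * w + η Y) (↭-length pp) (↭-length pw)) (budget v)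
    }
    where
    colours : cs S ++ ip P ++ κ ↭ cs S′ ++ ip P′ ++ κ
    colours = ++⁺ pc (++⁺ʳ κ (map⁺ idx pp))
    S≡ : length S ≡ length S′
    S≡ = trans (sym (length-map c S)) (trans (↭-length pc) (length-map c S′))

  reorder : ∀ {S S′ W W′ P P′ Z Y κ} → S ↭ S′ → W ↭ W′ → P ↭ P′ →
    Valid S W P Z Y κ → Valid S′ W′ P′ Z Y κ
  reorder p = valid-resp (vs-↭ p) (map⁺ c p)

  complete : ∀ {X K} R → X ⊩ K → X ++ R ↭ allFin n → Unique K → length K ≡ k → Goal
  complete {X} {K} R s p u l = K , ⊩-resp (↭-trans (++-comm R X) p) ↭-refl (⊩-weakenˡ R s) , u , l

  -- Augmentation and absorption.

  module _ {S : List Edge} {W : List V} {P : List Comp} {Z Y : List V} {κ : List ℕ} {ws : List V} {Ys : List Comp}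
    (v : Valid S (ws ++ W) (Ys ++ P) Z Y κ) where

    -- The edges of `S` and the components of `P` are not touched and keep their colours, so a local
    -- gain of one new colour suffices.
    supply⇒goal : ∀ {d} → ws ++ vp Ys ++ Z ++ Y ⊩ d ∷ ip Ys ++ κ →
      d ∉ cs S → d ∉ ip (Ys ++ P) ++ κ → Goal
    supply⇒goal {d} s d∉S d∉ = complete W
      (⊩-++ (⊩-edges S) (⊩-++ s (robust-pool P (keep ↭-refl))))
      (↭-trans (solve 7 (λ e w p z y w′ p′ → (e ⊕ ((w ⊕ (p ⊕ (z ⊕ y))) ⊕ p′)) ⊕ w′ ⊜
          e ⊕ ((w ⊕ w′) ⊕ ((p ⊕ p′) ⊕ (z ⊕ y)))) ↭-refl (vs S) ws (vp Ys) Z Y W (vp P))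
        (↭-trans (++⁺ˡ (vs S) (++⁺ˡ (ws ++ W) (++⁺ʳ (Z ++ Y) (↭-sym (vp-++ Ys P))))) (part v)))
      (uniq-resp (↭-sym perm) (uniq-∷ (λ m → [ d∉S , d∉ ]′ (∈-++⁻ (cs S) m)) (uniq v)))
      (trans (↭-length perm) (size v))
      where
      perm : cs S ++ (d ∷ ip Ys ++ κ) ++ ip P ↭ d ∷ cs S ++ ip (Ys ++ P) ++ κ
      perm = ↭-trans (solve 5 (λ e d i k p → e ⊕ ((d ⊕ (i ⊕ k)) ⊕ p) ⊜ d ⊕ (e ⊕ ((i ⊕ p) ⊕ k)))
          ↭-refl (cs S) (d ∷ []) (ip Ys) κ (ip P))
        (++⁺ˡ (d ∷ cs S) (++⁺ʳ κ (↭-sym (ip-++ Ys P))))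

  -- As long as `Es` is intact it supplies its own colours; once it is damaged, `A` does so. The
  -- inequality is the balance of the budget: three for each edge that leaves `S` against two for a
  -- free vertex and one for a component.
  grow : ∀ {Es S W P Z Y κ ws Ys A Y′} → Valid (Es ++ S) (ws ++ W) (Ys ++ P) Z Y κ →
    A ++ Y′ ↭ ws ++ vp Ys ++ Z ++ Y → Robust₂ A Y′ (ip Ys ++ κ) →
    (∀ {Y″} → Rem Y′ Y″ → A ++ Y″ ⊩ cs Es ++ ip Ys ++ κ) → length Y′ ≤ 4 →
    2 * length ws + length Ys + η Y ≤ 3 * length Es + η Y′ →
    Valid S W P (vs Es ++ A) Y′ (cs Es ++ ip Ys ++ κ)
  grow {Es} {S} {W} {P} {Z} {Y} {κ} {ws} {Ys} {A} {Y′} v pA r s small′ cost = record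
    { part = ↭-trans (solve 6 (λ e s w p a y → s ⊕ (w ⊕ (p ⊕ ((e ⊕ a) ⊕ y))) ⊜ ((e ⊕ s) ⊕ (w ⊕ p)) ⊕ (a ⊕ y))
          ↭-refl (vs Es) (vs S) W (vp P) A Y′)
        (↭-trans (++⁺ˡ ((vs Es ++ vs S) ++ W ++ vp P) pA)
        (↭-trans (solve 7 (λ s w p ws ys z y → (s ⊕ (w ⊕ p)) ⊕ (ws ⊕ (ys ⊕ (z ⊕ y))) ⊜ s ⊕ ((ws ⊕ w) ⊕
            ((ys ⊕ p) ⊕ (z ⊕ y))))
          ↭-refl (vs Es ++ vs S) W (vp P) ws (vp Ys) Z Y)
        (↭-trans (++⁺ (↭-sym (vs-++↭ Es S)) (++⁺ˡ (ws ++ W) (++⁺ʳ (Z ++ Y) (↭-sym (vp-++ Ys P))))) (part v))))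
    ; uniq = uniq-resp perm (uniq v)
    ; size = trans (cong suc (sym (↭-length perm))) (size v)
    ; rob = robust₂-merge Es r s
    ; small = small′
    ; budget = arith (length Es) (length S) (length ws) (length W) (length Ys) (length P) (η Y) (η Y′)
        (subst₂ _≤_ (cong (λ z → 3 * z + 11) (length-++ Es))
          (cong₂ (λ y w → y + 2 * w + η Y) (length-++ Ys) (length-++ ws)) (budget v)) cost
    }
    where
    perm : cs (Es ++ S) ++ ip (Ys ++ P) ++ κ ↭ cs S ++ ip P ++ cs Es ++ ip Ys ++ κ
    perm = ↭-trans (++⁺ (cs-++↭ Es S) (++⁺ʳ κ (ip-++ Ys P)))
      (solve 5 (λ e s i p k → (e ⊕ s) ⊕ ((i ⊕ p) ⊕ k) ⊜ s ⊕ (p ⊕ (e ⊕ (i ⊕ k)))) ↭-refl (cs Es) (cs S) (ip Ys) (ip P) κ)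
    arith : ∀ e s w′ w y p h h′ → 3 * (e + s) + 11 ≤ (y + p) + 2 * (w′ + w) + h →
      2 * w′ + y + h ≤ 3 * e + h′ → 3 * s + 11 ≤ p + 2 * w + h′
    arith e s w′ w y p h h′ b q = +-cancelˡ-≤ (3 * e) _ _ (begin
      3 * e + (3 * s + 11)              ≡⟨ lemma₁ e s ⟩
      3 * (e + s) + 11                  ≤⟨ b ⟩
      (y + p) + 2 * (w′ + w) + h        ≡⟨ lemma₂ w′ w y p h ⟩
      (2 * w′ + y + h) + (p + 2 * w)    ≤⟨ +-monoˡ-≤ (p + 2 * w) q ⟩
      (3 * e + h′) + (p + 2 * w)        ≡⟨ lemma₃ e w p h′ ⟩
      3 * e + (p + 2 * w + h′)          ∎)
      where
      open ≤-Reasoning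
      lemma₁ : ∀ e s → 3 * e + (3 * s + 11) ≡ 3 * (e + s) + 11
      lemma₁ = solve-∀
      lemma₂ : ∀ w′ w y p h → (y + p) + 2 * (w′ + w) + h ≡ (2 * w′ + y + h) + (p + 2 * w)
      lemma₂ = solve-∀
      lemma₃ : ∀ e w p h′ → (3 * e + h′) + (p + 2 * w) ≡ 3 * e + (p + 2 * w + h′)
      lemma₃ = solve-∀

  findEdge : ∀ {d} S → d ∈ cs S → ∃₂ λ e S′ → S ↭ e ∷ S′ × c e ≡ d
  findEdge S d∈ with ∈-map⁻ c d∈
  ... | e , e∈ , refl = let S′ , p = ∈⇒↭ e∈ in e , S′ , p , refl

  -- Either `d` is new, or it is the colour of an edge in `S`. In the second case the gain of `d`
  -- stands in for this edge, which can therefore be absorbed.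
  hit : ∀ {S W P Z Y κ ws Ys A Y′ d p₀} → Valid S (ws ++ W) (Ys ++ P) Z Y κ →
    A ++ Y′ ↭ ws ++ vp Ys ++ Z ++ Y → Robust₂ A Y′ (ip Ys ++ κ) →
    (∀ {Y″} → Rem Y′ Y″ → A ++ Y″ ⊩ d ∷ ip Ys ++ κ) → length Y′ ≤ 4 →
    2 * length ws + length Ys + η Y ≤ 3 + η Y′ → d ∉ ip (Ys ++ P) ++ κ → Step (length κ) p₀
  hit {S} {κ = κ} {ws} {Ys} {A} {Y′} {d} v pA r s small′ cost d∉ with d ∈ℕ? cs S
  ... | no d∉S = goal (supply⇒goal {ws = ws} {Ys} v (⊩-resp pA ↭-refl (s (keep ↭-refl))) d∉S d∉)
  ... | yes d∈S with findEdge S d∈S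
  ... | e , S′ , p , refl = κ↑ (config (grow {Es = e ∷ []} {ws = ws} {Ys}
      (reorder p ↭-refl ↭-refl v) pA r s small′ cost))
    (s≤s (≤-trans (m≤n+m (length κ) (length (ip Ys))) (≤-reflexive (sym (length-++ (ip Ys))))))

  -- Here `Y` stays apart, so the gain has to survive the loss of one of its vertices.
  hitKeep : ∀ {S W P Z Y κ d p₀} ws Ys → Valid S (ws ++ W) (Ys ++ P) Z Y κ →
    (∀ {Y″} → Rem Y Y″ → (ws ++ vp Ys) ++ (Z ++ Y″) ⊩ d ∷ ip Ys ++ κ) →
    2 * length ws + length Ys ≤ 3 → d ∉ ip (Ys ++ P) ++ κ → Step (length κ) p₀
  hitKeep {Z = Z} {Y} ws Ys v s cost = hit {ws = ws} {Ys} {A = (ws ++ vp Ys) ++ Z} v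
    (solve 4 (λ w y z h → ((w ⊕ y) ⊕ z) ⊕ h ⊜ w ⊕ (y ⊕ (z ⊕ h))) ↭-refl ws (vp Ys) Z Y)
    (robust₂-++ (robust-++ (robust-[] {ws}) (robust-pool Ys)) (rob v))
    (λ {Y″} m → ⊩-resp (↭-reflexive (sym (++-assoc (ws ++ vp Ys) Z Y″))) ↭-refl (s m))
    (small v) (+-monoˡ-≤ (η Y) cost)

  η≤1 : ∀ Y → η Y ≤ 1
  η≤1 [] = z≤n
  η≤1 (_ ∷ _) = ≤-refl

  -- Here `Y` is merged into the protected part. The gain may then use a vertex of `Y`, but the unit
  -- that `Y` contributes to the budget is lost, hence the bound two instead of three.
  hitAbsorb : ∀ {S W P Z Y κ d p₀} ws Ys → Valid S (ws ++ W) (Ys ++ P) Z Y κ →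
    (ws ++ vp Ys) ++ (Z ++ Y) ⊩ d ∷ ip Ys ++ κ →
    2 * length ws + length Ys ≤ 2 → d ∉ ip (Ys ++ P) ++ κ → Step (length κ) p₀
  hitAbsorb {Z = Z} {Y} ws Ys v s cost = hit {ws = ws} {Ys} {A = (ws ++ vp Ys) ++ (Z ++ Y)} v
    (solve 4 (λ w y z h → ((w ⊕ y) ⊕ (z ⊕ h)) ⊕ id ⊜ w ⊕ (y ⊕ (z ⊕ h))) ↭-refl ws (vp Ys) Z Y)
    r (λ { (keep p) → ⊩-resp (++-nil p) ↭-refl s ; (drop _ p) → ⊥-elim (nil p) })
    z≤n (≤-trans (+-mono-≤ cost (η≤1 Y)) ≤-refl)
    where
    r = unjoin (robust-++ (robust-++ (robust-[] {ws}) (robust-pool Ys)) (join (rob v)))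
    ++-nil : ∀ {X Y″ : List V} → [] ↭ Y″ → X ↭ X ++ Y″
    ++-nil {X} p = ↭-trans (↭-sym (++-identityʳ X)) (++⁺ˡ X p)
    nil : ∀ {v : V} {Y″ : List V} → [] ↭ v ∷ Y″ → ⊥
    nil p with ↭-length p
    ... | ()

  -- A common form for a free vertex and a vertex of a component: a new edge can end at `u` without
  -- costing a colour.
  record Block (u : V) (ws : List V) (Ys : List Comp) : Set where
    constructor block
    field
      {others} : List V
      split : ws ++ vp Ys ↭ u ∷ others
      holds : others ⊩ ip Ys

  single : ∀ w → Block w (w ∷ []) []
  single w = block ↭-refl ⊩-[]

  inComp : ∀ {u D} → u ∈ vc D → Block u [] (D ∷ [])
  inComp {u} {D} u∈ = let X , p = ∈⇒↭ u∈
                          q = ↭-trans (++-identityʳ (vc D)) p in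
    block q (robust-pool (D ∷ []) (drop u q))

  module _ {S : List Edge} {W : List V} {P : List Comp} {Z Y : List V} {κ : List ℕ} {u v : V} {d p₀ : ℕ}
    (e : col G u v ≡ just d) where

    block-block : ∀ {ws Ys ws′ Ys′} → Block u ws Ys → Block v ws′ Ys′ →
      Valid S ((ws ++ ws′) ++ W) ((Ys ++ Ys′) ++ P) Z Y κ →
      2 * length (ws ++ ws′) + length (Ys ++ Ys′) ≤ 3 → d ∉ ip ((Ys ++ Ys′) ++ P) ++ κ → Step (length κ) p₀
    block-block {ws} {Ys} {ws′} {Ys′} (block {X} p s) (block {X′} p′ s′) val cost = hitKeep (ws ++ ws′) (Ys ++ Ys′) val
      (λ {Y″} m → ⊩-resp
        (↭-trans (solve 5 (λ u v x x′ z → u ⊕ (v ⊕ ((x ⊕ x′) ⊕ z)) ⊜ (u ⊕ x) ⊕ ((v ⊕ x′) ⊕ z)) ↭-refl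
            (u ∷ []) (v ∷ []) X X′ (Z ++ Y″))
          (↭-trans (++⁺ (↭-sym p) (++⁺ʳ (Z ++ Y″) (↭-sym p′)))
          (↭-trans (solve 5 (λ w y w′ y′ z → (w ⊕ y) ⊕ ((w′ ⊕ y′) ⊕ z) ⊜ ((w ⊕ w′) ⊕ (y ⊕ y′)) ⊕ z) ↭-refl
            ws (vp Ys) ws′ (vp Ys′) (Z ++ Y″))
          (++⁺ʳ (Z ++ Y″) (++⁺ˡ (ws ++ ws′) (↭-sym (vp-++ Ys Ys′)))))))
        (++⁺ʳ κ (↭-sym (++⁺ˡ (d ∷ []) (ip-++ Ys Ys′))))
        (⊩-∷ e (⊩-++ (⊩-++ s s′) (rob val (keep ↭-refl) m)))) cost

    -- The new edge uses up the loss permitted in `Z`; the loss permitted in `Y` remains available,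
    -- so `Y` can be kept.
    block-Z : ∀ {ws Ys} → Block u ws Ys → v ∈ Z → Valid S (ws ++ W) (Ys ++ P) Z Y κ →
      2 * length ws + length Ys ≤ 3 → d ∉ ip (Ys ++ P) ++ κ → Step (length κ) p₀
    block-Z {ws} {Ys} (block {X} p s) v∈ val cost = hitKeep ws Ys val
      (λ {Y″} m → ⊩-resp
        (↭-trans (solve 5 (λ u v x z y → u ⊕ (v ⊕ (x ⊕ (z ⊕ y))) ⊜ (u ⊕ x) ⊕ ((v ⊕ z) ⊕ y)) ↭-refl
            (u ∷ []) (v ∷ []) X (proj₁ (∈⇒↭ v∈)) Y″)
          (++⁺ (↭-sym p) (++⁺ʳ Y″ (↭-sym (proj₂ (∈⇒↭ v∈))))))
        ↭-refl
        (⊩-∷ e (⊩-++ s (rob val (drop v (proj₂ (∈⇒↭ v∈))) m)))) cost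

    block-Y : ∀ {ws Ys} → Block u ws Ys → v ∈ Y → Valid S (ws ++ W) (Ys ++ P) Z Y κ →
      2 * length ws + length Ys ≤ 2 → d ∉ ip (Ys ++ P) ++ κ → Step (length κ) p₀
    block-Y {ws} {Ys} (block {X} p s) v∈ val cost = hitAbsorb ws Ys val
      (⊩-resp
        (↭-trans (solve 5 (λ u v x z y → u ⊕ (v ⊕ (x ⊕ (z ⊕ y))) ⊜ (u ⊕ x) ⊕ (z ⊕ (v ⊕ y))) ↭-refl
            (u ∷ []) (v ∷ []) X Z (proj₁ (∈⇒↭ v∈)))
          (++⁺ (↭-sym p) (++⁺ˡ Z (↭-sym (proj₂ (∈⇒↭ v∈))))))
        ↭-refl
        (⊩-∷ e (⊩-++ s (rob val (keep ↭-refl) (drop v (proj₂ (∈⇒↭ v∈))))))) cost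

    -- The edge uses exactly the two losses that `Robust₂` permits.
    Y-Z : u ∈ Y → v ∈ Z → Valid S W P Z Y κ → d ∉ ip P ++ κ → Step (length κ) p₀
    Y-Z u∈ v∈ val = hitAbsorb [] [] val
      (⊩-resp
        (↭-trans (solve 4 (λ u v z y → u ⊕ (v ⊕ (z ⊕ y)) ⊜ (v ⊕ z) ⊕ (u ⊕ y)) ↭-refl
            (u ∷ []) (v ∷ []) (proj₁ (∈⇒↭ v∈)) (proj₁ (∈⇒↭ u∈)))
          (++⁺ (↭-sym (proj₂ (∈⇒↭ v∈))) (↭-sym (proj₂ (∈⇒↭ u∈)))))
        ↭-refl
        (⊩-∷ e (rob val (drop v (proj₂ (∈⇒↭ v∈))) (drop u (proj₂ (∈⇒↭ u∈)))))) z≤n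

  -- Two free vertices cost four, too much for the absorption of one edge. Instead the new edge and
  -- the edge of `S` with its colour form a component, and the unit this adds to the pool restores
  -- the balance.
  free-free : ∀ {S W P Z Y κ w f d} → col G w f ≡ just d → Valid S (w ∷ f ∷ W) P Z Y κ →
    d ∉ ip P ++ κ → Step (length κ) (length P)
  free-free {S} {W} {P} {Z} {Y} {κ} {w} {f} {d} e v d∉ with d ∈ℕ? cs S
  ... | no d∉S = goal (supply⇒goal {ws = w ∷ f ∷ []} {[]} v (⊩-∷ e (rob v (keep ↭-refl) (keep ↭-refl))) d∉S d∉)
  ... | yes d∈S with findEdge S d∈S
  ... | e′ , S′ , p , eq = P↑ (config {S = S′} {W} {D ∷ P} {Z} {Y} {κ} (record
      { part = ↭-trans (solve 6 (λ s w e f p z → s ⊕ (w ⊕ ((e ⊕ f) ⊕ p ⊕ z)) ⊜ (e ⊕ s) ⊕ ((f ⊕ w) ⊕ (p ⊕ z))) ↭-refl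
          (vs S′) W (vs (e′ ∷ [])) (w ∷ f ∷ []) (vp P) (Z ++ Y)) (part v′)
      ; uniq = uniq-resp perm (uniq v′)
      ; size = trans (cong suc (sym (↭-length perm))) (size v′)
      ; rob = rob v
      ; small = small v
      ; budget = arith (length S′) (length W) (length P) (η Y) (budget v′)
      })) refl ≤-refl
    where
    v′ = reorder p ↭-refl ↭-refl v
    D = comp e′ (edge w f d e) eq
    perm : cs (e′ ∷ S′) ++ ip P ++ κ ↭ cs S′ ++ ip (D ∷ P) ++ κ
    perm = ↭-sym (shift (c e′) (cs S′) (ip P ++ κ))
    arith : ∀ s w p h → 3 * suc s + 11 ≤ p + 2 * suc (suc w) + h → 3 * s + 11 ≤ suc p + 2 * w + h
    arith s w p h b = +-cancelˡ-≤ 3 _ _ (≤-trans (≤-reflexive (l₁ s)) (≤-trans b (≤-trans (≤-reflexive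
        (l₂ w p h)) ≤-refl)))
      where
      l₁ : ∀ s → 3 + (3 * s + 11) ≡ 3 * suc s + 11
      l₁ = solve-∀
      l₂ : ∀ w p h → p + 2 * suc (suc w) + h ≡ 3 + (suc p + 2 * w + h)
      l₂ = solve-∀

  -- Crossed components.

  record Crossed (D : Comp) : Set where
    constructor crossed
    field
      e₃ e₄ : Edge
      cross : vc D ↭ vs (e₃ ∷ e₄ ∷ [])
  open Crossed public

  uncross : ∀ {D} → Crossed D → Crossed D
  uncross (crossed e₃ e₄ p) = crossed e₄ e₃ (↭-trans p (++-comm (vs (e₃ ∷ [])) (vs (e₄ ∷ []))))

  -- Which crossing edge misses `v` depends on `v`; the last component hands on any property that
  -- both crossing edges have.
  avoid : ∀ {D v} (X : Crossed D) → v ∈ vc D →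
    ∃₂ λ e v′ → vc D ↭ v ∷ v′ ∷ vs (e ∷ []) × (∀ {Q : Edge → Set} → Q (e₃ X) → Q (e₄ X) → Q e)
  avoid X@(crossed e₃ e₄ p) v∈ with ∈-++⁻ (vs (e₃ ∷ [])) (∈-resp-↭ p v∈)
  ... | inj₁ (here refl) = e₄ , b e₃ , p , λ _ q → q
  ... | inj₁ (there (here refl)) = e₄ , a e₃ , ↭-trans p (++⁺ʳ (vs (e₄ ∷ [])) (++-comm (a e₃ ∷ [])
      (b e₃ ∷ []))) , λ _ q → q
  ... | inj₂ (here refl) = e₃ , b e₄ , cross (uncross X) , λ q _ → q
  ... | inj₂ (there (here refl)) = e₃ , a e₄ , ↭-trans (cross (uncross X)) (++⁺ʳ (vs (e₃ ∷ [])) (++-comm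
      (a e₄ ∷ []) (b e₄ ∷ []))) , λ q _ → q

  robust-pair : ∀ {A B K L} → Robust A K → Robust B L → Robust₂ A B (L ++ K)
  robust-pair {K = K} {L} r s m t = ⊩-resp ↭-refl (++-comm K L) (⊩-++ (r m) (s t))

  -- The edge u v takes over the colour of `D`; this allows `D` to supply the colour of a crossing edge instead.
  module _ {S : List Edge} {W : List V} {P : List Comp} {Z Y : List V} {κ : List ℕ} {u v : V} {p₀ : ℕ} {D : Comp}
    (e : col G u v ≡ just (idx D)) (u∈ : u ∈ Y) where

    private
      Y∖u = proj₁ (∈⇒↭ u∈)
      Y↭ : Y ↭ u ∷ Y∖u
      Y↭ = proj₂ (∈⇒↭ u∈)

    released-own : (X : Crossed D) → c (e₃ X) ∉ ip (D ∷ P) ++ κ → c (e₄ X) ∉ ip (D ∷ P) ++ κ →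
      v ∈ vc D → Valid S W (D ∷ P) Z Y κ → Step (length κ) p₀
    released-own X n₃ n₄ v∈ val with avoid X v∈
    ... | g , v′ , q , either = hitAbsorb [] (D ∷ []) val
      (⊩-resp (↭-trans (solve 6 (λ x u v v′ z y → x ⊕ ((u ⊕ v) ⊕ (v′ ⊕ (z ⊕ y))) ⊜ (v ⊕ v′ ⊕ x) ⊕ (z ⊕ (u ⊕ y))) ↭-refl
            (vs (g ∷ [])) (u ∷ []) (v ∷ []) (v′ ∷ []) Z Y∖u)
          (++⁺ (↭-trans (↭-sym q) (↭-sym (++-identityʳ (vc D)))) (++⁺ˡ Z (↭-sym Y↭)))) ↭-refl
        (⊩-∷ (isE g) (⊩-∷ e (⊩-weakenˡ (v′ ∷ []) (rob val (keep ↭-refl) (drop u Y↭))))))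
      (s≤s z≤n) (either {λ e → c e ∉ ip (D ∷ P) ++ κ} n₃ n₄)

    released-block : ∀ {D′} (X : Crossed D) → c (e₃ X) ∉ ip (D ∷ D′ ∷ P) ++ κ →
      v ∈ vc D′ → Valid S W (D ∷ D′ ∷ P) Z Y κ → Step (length κ) p₀
    released-block {D′} X n₃ v∈ val with inComp {D = D′} v∈
    ... | block {X′} q s = hitAbsorb [] (D ∷ D′ ∷ []) val
      (⊩-resp (↭-trans (solve 7 (λ x x′ u v d z y → x ⊕ ((u ⊕ v) ⊕ (d ⊕ (x′ ⊕ (z ⊕ y)))) ⊜ ((x ⊕ x′) ⊕
          (v ⊕ d)) ⊕ (z ⊕ (u ⊕ y))) ↭-refl
            (vs (e₃ X ∷ [])) (vs (e₄ X ∷ [])) (u ∷ []) (v ∷ []) X′ Z Y∖u)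
          (++⁺ (++⁺ (↭-sym (cross X)) (↭-sym q)) (++⁺ˡ Z (↭-sym Y↭)))) ↭-refl
        (⊩-∷ (isE (e₃ X)) (⊩-∷ e (⊩-++ s (⊩-weakenˡ (vs (e₄ X ∷ [])) (rob val (keep ↭-refl) (drop u Y↭)))))))
      ≤-refl n₃

    released-Z : (X : Crossed D) → c (e₃ X) ∉ ip (D ∷ P) ++ κ →
      v ∈ Z → Valid S W (D ∷ P) Z Y κ → Step (length κ) p₀
    released-Z X n₃ v∈ val = hitAbsorb [] (D ∷ []) val
      (⊩-resp (↭-trans (solve 6 (λ x x′ u v z y → x ⊕ ((u ⊕ v) ⊕ (x′ ⊕ (z ⊕ y))) ⊜ (x ⊕ x′) ⊕ ((v ⊕ z) ⊕
          (u ⊕ y))) ↭-refl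
            (vs (e₃ X ∷ [])) (vs (e₄ X ∷ [])) (u ∷ []) (v ∷ []) (proj₁ (∈⇒↭ v∈)) Y∖u)
          (++⁺ (↭-trans (↭-sym (cross X)) (↭-sym (++-identityʳ (vc D)))) (++⁺ (↭-sym (proj₂ (∈⇒↭ v∈)))
              (↭-sym Y↭)))) ↭-refl
        (⊩-∷ (isE (e₃ X)) (⊩-∷ e (⊩-weakenˡ (vs (e₄ X ∷ [])) (rob val (drop v (proj₂ (∈⇒↭ v∈))) (drop u Y↭))))))
      (s≤s z≤n) n₃

    private
      freed : Robust₂ Z Y κ → (X : Crossed D) → v ∷ vp (D ∷ []) ++ Z ++ Y ⊩ c (e₃ X) ∷ idx D ∷ κ
      freed r X = ⊩-resp (↭-trans (solve 6 (λ x x′ u v z y → x ⊕ ((u ⊕ v) ⊕ (x′ ⊕ (z ⊕ y))) ⊜ (v ⊕ (x ⊕ x′)) ⊕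
          (z ⊕ (u ⊕ y))) ↭-refl
            (vs (e₃ X ∷ [])) (vs (e₄ X ∷ [])) (u ∷ []) (v ∷ []) Z Y∖u)
          (++⁺ (++⁺ˡ (v ∷ []) (↭-trans (↭-sym (cross X)) (↭-sym (++-identityʳ (vc D))))) (++⁺ˡ Z (↭-sym Y↭)))) ↭-refl
        (⊩-∷ (isE (e₃ X)) (⊩-∷ e (⊩-weakenˡ (vs (e₄ X ∷ [])) (r (keep ↭-refl) (drop u Y↭)))))

      base : Robust₂ Z Y κ → v ∷ Z ++ Y ⊩ idx D ∷ κ
      base r = ⊩-resp (↭-trans (solve 4 (λ u v z y → (u ⊕ v) ⊕ (z ⊕ y) ⊜ v ⊕ (z ⊕ (u ⊕ y))) ↭-refl
            (u ∷ []) (v ∷ []) Z Y∖u) (++⁺ˡ (v ∷ Z) (↭-sym Y↭))) ↭-refl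
          (⊩-∷ e (r (keep ↭-refl) (drop u Y↭)))

    -- Absorbing `v`, `D` and `Y` costs four, one more than a single edge of `S` pays for. With
    -- equal crossing colours, `D` takes the place of `Y`, which saves one unit. With different ones
    -- that both occur in `S`, two edges of `S` are absorbed at once.
    released-free : (X : Crossed D) → c (e₃ X) ∉ ip (D ∷ P) ++ κ → c (e₄ X) ∉ ip (D ∷ P) ++ κ →
      Valid S (v ∷ W) (D ∷ P) Z Y κ → Step (length κ) p₀
    released-free X n₃ n₄ val with c (e₃ X) ℕ.≟ c (e₄ X) | c (e₃ X) ∈ℕ? cs S | c (e₄ X) ∈ℕ? cs S
    ... | yes same | _ | _ = hit {ws = v ∷ []} {D ∷ []} {A = v ∷ Z ++ Y} {vc D} val
      (solve 4 (λ v d z y → (v ⊕ (z ⊕ y)) ⊕ d ⊜ v ⊕ ((d ⊕ id) ⊕ (z ⊕ y))) ↭-refl (v ∷ []) (vc D) Z Y)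
      (robust-pair (robust-++ (robust-[] {v ∷ []}) (join (rob val))) (robust-comp D))
      -- After the loss of a vertex of `D`, one crossing edge is still intact, while the colour of
      -- `D` comes from the edge u v.
      (λ {Y″} m → ⊩-resp (++-comm Y″ (v ∷ Z ++ Y)) ↭-refl
        (⊩-++ (robust-resp (↭-sym (cross X)) ↭-refl (robust-edges (e₃ X) (e₄ X) same) m) (base (rob val))))
      ≤-refl (+-monoʳ-≤ 3 (η≤1 Y)) n₃
    ... | no _ | no n | _ = goal (supply⇒goal {ws = v ∷ []} {D ∷ []} val (freed (rob val) X) n n₃)
    ... | no _ | yes _ | no n = goal (supply⇒goal {ws = v ∷ []} {D ∷ []} val (freed (rob val) (uncross X)) n n₄)
    ... | no different | yes m₃ | yes m₄ with findEdge S m₃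
    ... | g , S₁ , p₁ , refl with findEdge S₁ (later (∈-resp-↭ (map⁺ c p₁) m₄))
      where
      later : c (e₄ X) ∈ c g ∷ cs S₁ → c (e₄ X) ∈ cs S₁
      later (here q) = ⊥-elim (different (sym q))
      later (there m) = m
    ... | g′ , S₂ , p₂ , refl = κ↑
      (config (grow {Es = g ∷ g′ ∷ []} {ws = v ∷ []} {D ∷ []} {A = (v ∷ vp (D ∷ [])) ++ Z ++ Y} {[]}
        (reorder (↭-trans p₁ (_↭_.prep g p₂)) ↭-refl ↭-refl val)
        (++-identityʳ _)
        (unjoin (robust-++ (robust-++ (robust-[] {v ∷ []}) (robust-pool (D ∷ []))) (join (rob val))))
        both z≤n (s≤s (s≤s (s≤s (≤-trans (η≤1 Y) (s≤s z≤n)))))))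
      (s≤s (≤-trans (n≤1+n _) (n≤1+n _)))
      where
      both : ∀ {Y″} → Rem [] Y″ → ((v ∷ vp (D ∷ [])) ++ Z ++ Y) ++ Y″ ⊩ c (e₃ X) ∷ c (e₄ X) ∷ idx D ∷ κ
      both (drop _ p) with ↭-length p
      ... | ()
      both (keep p) = ⊩-resp
        (↭-trans (solve 4 (λ x v z y → x ⊕ (v ⊕ (z ⊕ y)) ⊜ (v ⊕ (x ⊕ id)) ⊕ (z ⊕ y)) ↭-refl (vs
            (e₃ X ∷ e₄ X ∷ [])) (v ∷ []) Z Y)
        (↭-trans (++⁺ʳ (Z ++ Y) (++⁺ˡ (v ∷ []) (++⁺ʳ [] (↭-sym (cross X)))))
        (↭-trans (↭-sym (++-identityʳ _)) (++⁺ˡ ((v ∷ vp (D ∷ [])) ++ Z ++ Y) p)))) ↭-refl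
        (⊩-++ (⊩-edges (e₃ X ∷ e₄ X ∷ [])) (base (rob val)))

  -- Alternating exchanges.

  -- An alternating path from `e` to `src` frees the vertex `b e` and exchanges the colour of `e` for one outside `U`;
  -- the path itself is not recorded.
  record Freeable (U : List ℕ) (Hs : List Edge) (src : List V) (e : Edge) : Set where
    constructor freeable
    field
      {others} : List V
      {K} : List ℕ
      {fresh} : ℕ
      split : vs Hs ++ src ↭ b e ∷ others
      holds : others ⊩ K
      traded : c e ∷ K ↭ fresh ∷ cs Hs
      isFresh : fresh ∉ U

  module _ {U : List ℕ} {Hs : List Edge} {src : List V} {w : V} {d : ℕ} {e : Edge}
    (g : col G w (a e) ≡ just d) where

    freeable-old : ∀ {e′} → Freeable U Hs src e′ → Freeable U (e ∷ Hs) (w ∷ src) e′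
    freeable-old {e′} (freeable {R} {K} {β} p s q f) = freeable
      (↭-trans (solve 4 (λ e h w s → e ⊕ (h ⊕ (w ⊕ s)) ⊜ (w ⊕ e) ⊕ (h ⊕ s)) ↭-refl (vs (e ∷ [])) (vs Hs) (w ∷ []) src)
        (↭-trans (++⁺ˡ (w ∷ vs (e ∷ [])) p)
          (solve 3 (λ b x r → x ⊕ (b ⊕ r) ⊜ b ⊕ (x ⊕ r)) ↭-refl (b e′ ∷ []) (w ∷ vs (e ∷ [])) R)))
      (⊩-weakenˡ (w ∷ []) (⊩-∷ (isE e) s))
      (↭-trans (_↭_.swap (c e′) (c e) ↭-refl) (↭-trans (_↭_.prep (c e) q) (_↭_.swap (c e) β ↭-refl))) f

    -- The edge from `w` to `a e` replaces `e` and so frees `b e`. If its colour belongs to a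
    -- promoted edge `e′`, the exchange for `e′` first gives up this colour; otherwise `d` itself is
    -- the fresh colour.
    freeable-new : All (Freeable U Hs src) Hs → d ∈ cs Hs ⊎ d ∉ U → Freeable U (e ∷ Hs) (w ∷ src) e
    freeable-new fs (inj₁ d∈) with ∈-map⁻ c d∈
    ... | e′ , e′∈ , refl with All.lookup fs e′∈
    ... | freeable {R} {K} {β} p s q f = freeable
      (↭-trans (solve 5 (λ a b h w s → (a ⊕ b) ⊕ (h ⊕ (w ⊕ s)) ⊜ b ⊕ ((w ⊕ a) ⊕ (h ⊕ s))) ↭-refl
          (a e ∷ []) (b e ∷ []) (vs Hs) (w ∷ []) src)
        (++⁺ˡ (b e ∷ w ∷ a e ∷ []) p))
      (⊩-∷ g (⊩-weakenˡ (b e′ ∷ []) s))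
      (↭-trans (_↭_.prep (c e) q) (_↭_.swap (c e) β ↭-refl)) f
    freeable-new fs (inj₂ d∉) = freeable
      (solve 5 (λ a b h w s → (a ⊕ b) ⊕ (h ⊕ (w ⊕ s)) ⊜ b ⊕ ((w ⊕ a) ⊕ (h ⊕ s))) ↭-refl
          (a e ∷ []) (b e ∷ []) (vs Hs) (w ∷ []) src)
      (⊩-∷ g (⊩-resp (++-comm src (vs Hs)) ↭-refl (⊩-weakenˡ src (⊩-edges Hs))))
      (_↭_.swap (c e) d ↭-refl) d∉

    promote : All (Freeable U Hs src) Hs → d ∈ cs Hs ⊎ d ∉ U → All (Freeable U (e ∷ Hs) (w ∷ src)) (e ∷ Hs)
    promote fs m = freeable-new fs m ∷ All.map freeable-old fs

  -- The vertex `unit` serves as the source of a promotion. As `kept` retains the colour of the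
  -- component, `mate` becomes free too.
  record Used : Set where
    constructor used
    field
      whole : Comp
      unit mate : V
      kept : Edge
      apart : vc whole ↭ unit ∷ mate ∷ vs (kept ∷ [])
      kept-idx : c kept ≡ idx whole
  open Used public

  vp-used : ∀ Us → vp (map whole Us) ↭ map unit Us ++ map mate Us ++ vs (map kept Us)
  vp-used [] = ↭-refl
  vp-used (U ∷ Us) = ↭-trans (++⁺ (apart U) (vp-used Us))
    (solve 6 (λ u m e us ms es → (u ⊕ (m ⊕ e)) ⊕ (us ⊕ (ms ⊕ es)) ⊜ (u ⊕ us) ⊕ ((m ⊕ ms) ⊕ (e ⊕ es))) ↭-refl
      (unit U ∷ []) (mate U ∷ []) (vs (kept U ∷ [])) (map unit Us) (map mate Us) (vs (map kept Us)))

  ip-used : ∀ Us → cs (map kept Us) ≡ ip (map whole Us)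
  ip-used [] = refl
  ip-used (U ∷ Us) = cong₂ _∷_ (kept-idx U) (ip-used Us)

  module _ {Hs T : List Edge} {W Z Y : List V} {κ : List ℕ} {src todo : List V} {e : Edge} {U : List ℕ}
    (Us : List Used) (Un : List Comp)
    (val : Valid (Hs ++ T) W (map whole Us ++ Un) Z Y κ)
    (sources : src ++ todo ↭ W ++ map unit Us)
    (colours : cs (Hs ++ T) ++ ip (map whole Us ++ Un) ++ κ ↭ U) where

    -- A used component is dissolved into an edge of `S` and a free vertex, which does not change the slack of
    -- the budget.
    rebase : Freeable U Hs src e → ∃₂ λ S′ rest → Valid S′ (b e ∷ rest ++ todo ++ map mate Us) Un Z Y κ
    rebase (freeable {R} {K} {β} p (supply es rest q r) t f) = es ++ T ++ gs , rest , record
      { part = ↭-trans (++⁺ʳ ((b e ∷ rest ++ todo ++ ms) ++ vp Un ++ Z ++ Y)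
            (↭-trans (vs-++↭ es (T ++ gs)) (++⁺ˡ (vs es) (vs-++↭ T gs))))
          (↭-trans (solve 9 (λ es t gs b r td ms u zy → (es ⊕ (t ⊕ gs)) ⊕ ((b ⊕ (r ⊕ (td ⊕ ms))) ⊕ (u ⊕ zy)) ⊜
              ((b ⊕ (es ⊕ r)) ⊕ td) ⊕ (t ⊕ ((ms ⊕ gs) ⊕ (u ⊕ zy)))) ↭-refl
              (vs es) (vs T) (vs gs) (b e ∷ []) rest todo ms (vp Un) (Z ++ Y))
          (↭-trans (++⁺ʳ _ (++⁺ʳ todo (↭-trans (++⁺ˡ (b e ∷ []) (↭-sym q)) (↭-sym p))))
          (↭-trans (solve 6 (λ h s td t mg uzy → ((h ⊕ s) ⊕ td) ⊕ (t ⊕ (mg ⊕ uzy)) ⊜ (s ⊕ td) ⊕ ((h ⊕ t) ⊕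
              (mg ⊕ uzy))) ↭-refl
              (vs Hs) src todo (vs T) (ms ++ vs gs) (vp Un ++ Z ++ Y))
          (↭-trans (++⁺ʳ _ sources)
          (↭-trans (solve 6 (λ w us ht mg u zy → (w ⊕ us) ⊕ (ht ⊕ (mg ⊕ (u ⊕ zy))) ⊜ ht ⊕ (w ⊕
              (((us ⊕ mg) ⊕ u) ⊕ zy))) ↭-refl
              W (map unit Us) (vs Hs ++ vs T) (ms ++ vs gs) (vp Un) (Z ++ Y))
          (↭-trans (++⁺ (↭-sym (vs-++↭ Hs T)) (++⁺ˡ W (++⁺ʳ (Z ++ Y)
              (↭-trans (++⁺ʳ (vp Un) (↭-sym (vp-used Us))) (↭-sym (vp-++ (map whole Us) Un))))))
            (part val)))))))
      ; uniq = uniq-tail (uniq-resp (↭-sym shifted) (uniq-∷ f (uniq-resp colours (uniq val))))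
      ; size = trans (↭-length shifted) (trans (cong suc (sym (↭-length colours))) (size val))
      ; rob = rob val
      ; small = small val
      ; budget = subst₂ _≤_ (cong (λ z → 3 * z + 11) (sym S-length)) (cong (λ z → length Un + 2 * z + η Y)
          (sym W-length))
          (arith (length Hs) (length T) (length Us) (length W) (length Un) (η Y)
            (subst₂ _≤_ (cong (λ z → 3 * z + 11) (length-++ Hs))
              (cong (λ z → z + 2 * length W + η Y) (trans (length-++ (map whole Us)) (cong (_+ length Un)
                  (length-map whole Us))))
              (budget val)))
      }
      where
      gs = map kept Us
      ms = map mate Us
      -- The new colours arise from `U` by exchanging `c e` for `β`. Adding one colour on each side
      -- avoids deleting from a multiset.
      shifted : c e ∷ cs (es ++ T ++ gs) ++ ip Un ++ κ ↭ β ∷ U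
      shifted =
        ↭-trans (++⁺ˡ (c e ∷ []) (++⁺ʳ (ip Un ++ κ) (↭-trans (cs-++↭ es (T ++ gs)) (++⁺ r (↭-trans
            (cs-++↭ T gs) (++⁺ˡ (cs T) (↭-reflexive (ip-used Us))))))))
        (↭-trans (solve 6 (λ e k t g u κ → e ⊕ ((k ⊕ (t ⊕ g)) ⊕ (u ⊕ κ)) ⊜ (e ⊕ k) ⊕ (t ⊕ ((g ⊕ u) ⊕ κ))) ↭-refl
            (c e ∷ []) K (cs T) (ip (map whole Us)) (ip Un) κ)
        (↭-trans (++⁺ t (++⁺ˡ (cs T) (++⁺ʳ κ (↭-sym (ip-++ (map whole Us) Un)))))
        (↭-trans (solve 4 (λ b h t i → (b ⊕ h) ⊕ (t ⊕ i) ⊜ b ⊕ ((h ⊕ t) ⊕ i)) ↭-refl (β ∷ []) (cs Hs) (cs T)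
            (ip (map whole Us ++ Un) ++ κ))
        (++⁺ˡ (β ∷ []) (↭-trans (++⁺ʳ _ (↭-sym (cs-++↭ Hs T))) colours)))))
      es≡Hs : length es ≡ length Hs
      es≡Hs = trans (sym (length-map c es)) (trans (↭-length r) (trans (suc-injective (↭-length t)) (length-map c Hs)))
      S-length : length (es ++ T ++ gs) ≡ length Hs + (length T + length Us)
      S-length = trans (length-++ es) (cong₂ _+_ es≡Hs (trans (length-++ T) (cong (length T +_) (length-map kept Us))))
      src-length : length src ≡ suc (length rest)
      src-length = +-cancelˡ-≡ (length Hs + length Hs) _ _ (trans (cong (_+ length src) (sym (length-vs Hs)))
        (trans (sym (length-++ (vs Hs))) (trans (↭-length p) (trans (cong suc (trans (↭-length q) (trans
            (length-++ (vs es))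
          (cong (_+ length rest) (trans (length-vs es) (cong₂ _+_ es≡Hs es≡Hs)))))) (sym (+-suc _ (length rest)))))))
      W-length : length (b e ∷ rest ++ todo ++ ms) ≡ length W + length Us + length Us
      W-length = trans (cong suc (trans (length-++ rest) (cong (length rest +_) (trans (length-++ todo) (cong
          (length todo +_) (length-map mate Us))))))
        (trans (sym (+-assoc (suc (length rest)) (length todo) (length Us))) (cong (_+ length Us)
          (trans (cong (_+ length todo) (sym src-length)) (trans (sym (length-++ src)) (trans (↭-length sources)
            (trans (length-++ W) (cong (length W +_) (length-map unit Us))))))))
      -- For each used component both sides grow by three: on the right one component is lost and
      -- two free vertices, worth two each, are gained.
      arith : ∀ h t u w n y → 3 * (h + t) + 11 ≤ (u + n) + 2 * w + y → 3 * (h + (t + u)) + 11 ≤ n + 2 * (w + u + u) + y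
      arith h t u w n y q = ≤-trans (≤-reflexive (l₁ h t u)) (≤-trans (+-monoʳ-≤ (3 * u) q) (≤-reflexive (l₂ u w n y)))
        where
        l₁ : ∀ h t u → 3 * (h + (t + u)) + 11 ≡ 3 * u + (3 * (h + t) + 11)
        l₁ = solve-∀
        l₂ : ∀ u w n y → 3 * u + ((u + n) + 2 * w + y) ≡ n + 2 * (w + u + u) + y
        l₂ = solve-∀

-- The search for a step.

module Search {n : ℕ} (G : ColouredGraph n) (k : ℕ) (δ : ∀ v → k ≤ colourDegree G v) where
  open Structure G k public

  data Place (S : List Edge) (W : List V) (P : List Comp) (Z Y : List V) (v : V) : Set where
    inS : v ∈ vs S → Place S W P Z Y v
    inW : v ∈ W → Place S W P Z Y v
    inP : v ∈ vp P → Place S W P Z Y v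
    inZ : v ∈ Z → Place S W P Z Y v
    inY : v ∈ Y → Place S W P Z Y v

  locate : ∀ {S W P Z Y κ} → Valid S W P Z Y κ → ∀ v → Place S W P Z Y v
  locate {S} {W} {P} {Z} val v with ∈-++⁻ (vs S) (∈-resp-↭ (↭-sym (part val)) (∈-allFin v))
  ... | inj₁ m = inS m
  ... | inj₂ m with ∈-++⁻ W m
  ... | inj₁ m = inW m
  ... | inj₂ m with ∈-++⁻ (vp P) m
  ... | inj₁ m = inP m
  ... | inj₂ m with ∈-++⁻ Z m
  ... | inj₁ m = inZ m
  ... | inj₂ m = inY m

  endpoint : ∀ {v} S → v ∈ vs S → (∃ λ e → e ∈ S × v ≡ a e) ⊎ (∃ λ e → e ∈ S × v ≡ b e)
  endpoint (e ∷ S) (here eq) = inj₁ (e , here refl , eq)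
  endpoint (e ∷ S) (there (here eq)) = inj₂ (e , here refl , eq)
  endpoint (e ∷ S) (there (there m)) with endpoint S m
  ... | inj₁ (e , m , eq) = inj₁ (e , there m , eq)
  ... | inj₂ (e , m , eq) = inj₂ (e , there m , eq)

  -- The end at which an edge is reached becomes its first endpoint, so that promotion frees the
  -- other end.
  orient : ∀ {v} T → v ∈ vs T → ∃₂ λ e T′ → a e ≡ v × vs T ↭ vs (e ∷ T′) × cs T ↭ cs (e ∷ T′)
  orient T v∈ with endpoint T v∈
  ... | inj₁ (e , m , refl) = let T′ , p = ∈⇒↭ m in e , T′ , refl , vs-↭ p , map⁺ c p
  ... | inj₂ (e , m , refl) = let T′ , p = ∈⇒↭ m in
    flip e , T′ , refl , ↭-trans (vs-↭ p) (_↭_.swap (a e) (b e) ↭-refl) , map⁺ c p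

  findComp : ∀ {v} P → v ∈ vp P → ∃₂ λ D P′ → P ↭ D ∷ P′ × v ∈ vc D
  findComp (D ∷ P) v∈ with ∈-++⁻ (vc D) v∈
  ... | inj₁ m = D , P , ↭-refl , m
  ... | inj₂ m = let D′ , P′ , p , q = findComp P m in
    D′ , D ∷ P′ , ↭-trans (_↭_.prep D p) (_↭_.swap D D′ ↭-refl) , q

  findIdx : ∀ {d} P → d ∈ ip P → ∃₂ λ D P′ → P ↭ D ∷ P′ × idx D ≡ d
  findIdx P d∈ with ∈-map⁻ idx d∈
  ... | D , D∈ , refl = let P′ , p = ∈⇒↭ D∈ in D , P′ , p , refl

  sym-col : ∀ {u v d} → col G u v ≡ just d → col G v u ≡ just d
  sym-col {u} {v} e = trans (col-sym G v u) e

  ∉-resp : ∀ {d} {P P′ : List Comp} {κ} → P ↭ P′ → d ∉ ip P ++ κ → d ∉ ip P′ ++ κ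
  ∉-resp {κ = κ} p d∉ m = d∉ (∈-resp-↭ (++⁺ʳ κ (map⁺ idx (↭-sym p))) m)

  module _ {Hs T : List Edge} {e : Edge} {T′ : List Edge} (pv : vs T ↭ vs (e ∷ T′)) (pc : cs T ↭ cs (e ∷ T′)) where

    move-vs : vs (Hs ++ T) ↭ vs ((e ∷ Hs) ++ T′)
    move-vs = ↭-trans (vs-++↭ Hs T) (↭-trans (++⁺ˡ (vs Hs) pv)
      (↭-trans (solve 3 (λ h e t → h ⊕ (e ⊕ t) ⊜ e ⊕ (h ⊕ t)) ↭-refl (vs Hs) (vs (e ∷ [])) (vs T′))
        (↭-sym (vs-++↭ (e ∷ Hs) T′))))

    move-cs : cs (Hs ++ T) ↭ cs ((e ∷ Hs) ++ T′)
    move-cs = ↭-trans (cs-++↭ Hs T) (↭-trans (++⁺ˡ (cs Hs) pc)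
      (↭-trans (shift (c e) (cs Hs) (cs T′)) (↭-sym (cs-++↭ (e ∷ Hs) T′))))

  -- Each of the `k` - 1 colours counts once: a promoted edge excludes its first endpoint instead of
  -- its colour.
  room : ∀ {Hs T W P Z Y κ} → Valid (Hs ++ T) W P Z Y κ →
    length (cs T ++ ip P ++ κ) + length (map a Hs) < k
  room {Hs} {T} {P = P} {κ = κ} val = ≤-reflexive (trans (cong suc (sym (trans
      (trans (↭-length (++⁺ʳ (ip P ++ κ) (cs-++↭ Hs T))) (trans (cong length (++-assoc (cs Hs) (cs T) (ip P ++ κ)))
        (trans (length-++ (cs Hs)) (cong (_+ length (cs T ++ ip P ++ κ)) (trans (length-map c Hs) (sym
            (length-map a Hs)))))))
      (+-comm (length (map a Hs)) _)))) (size val))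

  occupied : ∀ {Hs T U} {P : List Comp} {κ d} → cs (Hs ++ T) ++ ip P ++ κ ↭ U → d ∉ cs T ++ ip P ++ κ →
    d ∈ cs Hs ⊎ d ∉ U
  occupied {Hs} {T} {P = P} {κ} {d} p d∉ with d ∈ℕ? cs Hs
  ... | yes m = inj₁ m
  ... | no d∉H = inj₂ λ m → case (∈-++⁻ (cs Hs) (∈-resp-↭ (↭-trans (↭-sym p)
      (↭-trans (++⁺ʳ (ip P ++ κ) (cs-++↭ Hs T)) (↭-reflexive (++-assoc (cs Hs) (cs T) (ip P ++ κ))))) m))
    where
    case : d ∈ cs Hs ⊎ d ∈ cs T ++ ip P ++ κ → ⊥
    case = [ d∉H , d∉ ]′

  -- A bipartite graph with two vertices on each side has a perfect matching or an isolated vertex.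
  -- This is applied to the joining edges with colours outside `B`; an isolated vertex becomes the
  -- `unit`, and an admissible edge found there must leave the component.
  classify : ∀ B D → idx D ∈ B →
    (∃ λ U → whole U ≡ D × (∀ {q} → q ∈ vc D → ¬ Sees (unit U) B q)) ⊎
    (∃ λ (X : Crossed D) → c (e₃ X) ∉ B × c (e₄ X) ∉ B)
  classify B D@(comp (edge x y i p) (edge z w .i q) refl) i∈
    with sees? x B z | sees? x B w | sees? y B z | sees? y B w
  ... | yes (d , e , d∉) | _ | _ | yes (d′ , e′ , d′∉) = inj₂
    (crossed (edge x z d e) (edge y w d′ e′)
      (_↭_.prep x (_↭_.swap y z ↭-refl)) , d∉ , d′∉)
  ... | _ | yes (d , e , d∉) | yes (d′ , e′ , d′∉) | _ = inj₂
    (crossed (edge x w d e) (edge y z d′ e′)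
      (_↭_.prep x (solve 3 (λ y z w → y ⊕ (z ⊕ w) ⊜ w ⊕ (y ⊕ z)) ↭-refl (y ∷ []) (z ∷ []) (w ∷ []))) , d∉ , d′∉)
  ... | no n₁ | no n₂ | _ | _ = inj₁ (used D x y (edge z w i q) ↭-refl refl , refl , λ
    { (here refl) (_ , e , _) → case trans (sym (col-irr G x)) e of λ ()
    ; (there (here refl)) (d , e , d∉) → d∉ (subst (_∈ B) (just-injective (trans (sym p) e)) i∈)
    ; (there (there (here refl))) → n₁
    ; (there (there (there (here refl)))) → n₂ })
  ... | _ | _ | no n₃ | no n₄ = inj₁ (used D y x (edge z w i q) (_↭_.swap x y ↭-refl) refl , refl , λ
    { (here refl) (d , e , d∉) → d∉ (subst (_∈ B) (just-injective (trans (sym (sym-col p)) e)) i∈)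
    ; (there (here refl)) (_ , e , _) → case trans (sym (col-irr G y)) e of λ ()
    ; (there (there (here refl))) → n₃
    ; (there (there (there (here refl)))) → n₄ })
  ... | no n₁ | _ | no n₃ | _ = inj₁ (used D z w (edge x y i p)
      (++-comm (x ∷ y ∷ []) (z ∷ w ∷ [])) refl , refl , λ
    { (here refl) (d , e , d∉) → n₁ (d , sym-col e , d∉)
    ; (there (here refl)) (d , e , d∉) → n₃ (d , sym-col e , d∉)
    ; (there (there (here refl))) (_ , e , _) → case trans (sym (col-irr G z)) e of λ ()
    ; (there (there (there (here refl)))) (d , e , d∉) → d∉ (subst (_∈ B) (just-injective (trans (sym q) e)) i∈) })
  ... | _ | no n₂ | _ | no n₄ = inj₁ (used D w z (edge x y i p)
      (↭-trans (++-comm (x ∷ y ∷ []) (z ∷ w ∷ [])) (_↭_.swap z w ↭-refl)) refl , refl , λ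
    { (here refl) (d , e , d∉) → n₂ (d , sym-col e , d∉)
    ; (there (here refl)) (d , e , d∉) → n₄ (d , sym-col e , d∉)
    ; (there (there (here refl))) (d , e , d∉) → d∉ (subst (_∈ B) (just-injective (trans (sym (sym-col q)) e)) i∈)
    ; (there (there (there (here refl)))) (_ , e , _) → case trans (sym (col-irr G w)) e of λ () })

  classifyAll : ∀ B Un → (∀ {D} → D ∈ Un → idx D ∈ B) →
    (∃₂ λ U Un′ → Un ↭ whole U ∷ Un′ × (∀ {q} → q ∈ vc (whole U) → ¬ Sees (unit U) B q)) ⊎
    (∀ {D} → D ∈ Un → ∃ λ (X : Crossed D) → c (e₃ X) ∉ B × c (e₄ X) ∉ B)
  classifyAll B [] _ = inj₂ λ ()
  classifyAll B (D ∷ Un) h with classify B D (h (here refl))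
  ... | inj₁ (U , refl , f) = inj₁ (U , Un , ↭-refl , f)
  ... | inj₂ X with classifyAll B Un (λ m → h (there m))
  ... | inj₁ (U , Un′ , p , f) = inj₁ (U , D ∷ Un′ , ↭-trans (_↭_.prep D p) (_↭_.swap D (whole U) ↭-refl) , f)
  ... | inj₂ f = inj₂ λ { (here refl) → X ; (there m) → f m }

  no-loop : ∀ {v d} → col G v v ≡ just d → ⊥
  no-loop {v} e with trans (sym (col-irr G v)) e
  ... | ()

  ∈-map-a : ∀ {e Hs} → e ∈ Hs → a e ∈ map a Hs
  ∈-map-a = ∈-map⁺ a

  -- The stuck case.

  -- A crossed component in `Un` can give up its own colour, so the colours of `Un` are admitted here too. This makes
  -- up for excluding `vs T` altogether.
  module Stuck {Hs T : List Edge} {W Z : List V} {u : V} {Y : List V} {κ U : List ℕ} {src : List V}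
    (Us : List Used) (Un : List Comp)
    (val : Valid (Hs ++ T) W (map whole Us ++ Un) Z (u ∷ Y) κ)
    (sources : src ↭ W ++ map unit Us)
    (colours : cs (Hs ++ T) ++ ip (map whole Us ++ Un) ++ κ ↭ U)
    (fs : All (Freeable U Hs src) Hs)
    (few : length (cs T ++ ip (map whole Us) ++ κ) + length (map a Hs ++ vs T ++ u ∷ Y) < k)
    (crossing : ∀ {D} → D ∈ Un → ∃ λ (X : Crossed D) →
      c (e₃ X) ∉ cs T ++ ip (map whole Us ++ Un) ++ κ × c (e₄ X) ∉ cs T ++ ip (map whole Us ++ Un) ++ κ)
    where

    private
      P = map whole Us ++ Un
      B = cs T ++ ip P ++ κ

      rebased : ∀ {e} → e ∈ Hs → ∃₂ λ S′ rest → Valid S′ (b e ∷ rest ++ [] ++ map mate Us) Un Z (u ∷ Y) κ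
      rebased m = rebase Us Un val (↭-trans (++-identityʳ src) sources) colours (All.lookup fs m)

      shrink : ∀ {d} → d ∉ ip P ++ κ → d ∉ ip Un ++ κ
      shrink d∉ m = d∉ ([ (λ m → ∈-++⁺ˡ (∈-resp-↭ (↭-sym (ip-++ (map whole Us) Un)) (∈-++⁺ʳ (ip (map whole Us)) m)))
        , ∈-++⁺ʳ (ip P) ]′ (∈-++⁻ (ip Un) m))

    plain : ∀ {v d p₀} → col G u v ≡ just d → d ∉ ip P ++ κ → v ∉ map a Hs ++ vs T ++ u ∷ Y → Step (length κ) p₀
    plain {v} e d∉ v∉ with locate val v
    ... | inY m = ⊥-elim (v∉ (∈-++⁺ʳ (map a Hs) (∈-++⁺ʳ (vs T) m)))
    ... | inZ m = Y-Z e (here refl) m val d∉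
    ... | inW m = let W′ , p = ∈⇒↭ m in
      block-Y (sym-col e) (single v) (here refl) (reorder ↭-refl p ↭-refl val) ≤-refl d∉
    ... | inP m = let D , P′ , p , v∈ = findComp P m in
      block-Y (sym-col e) (inComp v∈) (here refl) (reorder ↭-refl ↭-refl p val) (s≤s z≤n) (∉-resp p d∉)
    ... | inS m with ∈-++⁻ (vs Hs) (∈-resp-↭ (vs-++↭ Hs T) m)
    ... | inj₂ m = ⊥-elim (v∉ (∈-++⁺ʳ (map a Hs) (∈-++⁺ˡ m)))
    ... | inj₁ m with endpoint Hs m
    ... | inj₁ (_ , m , refl) = ⊥-elim (v∉ (∈-++⁺ˡ (∈-map-a m)))
    -- `v` is the second endpoint of a promoted edge, so the exchange turns it into a free vertex.
    ... | inj₂ (_ , m , refl) = let S′ , rest , val′ = rebased m in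
      block-Y (sym-col e) (single v) (here refl) val′ ≤-refl (shrink d∉)

    released : ∀ {v D Un′ p₀} → Un ↭ D ∷ Un′ → col G u v ≡ just (idx D) → v ∉ map a Hs ++ vs T ++ u ∷ Y →
      Step (length κ) p₀
    released {v} {D} {Un′} p e v∉ with crossing (∈-resp-↭ (↭-sym p) (here refl))
    ... | X , n₃ , n₄ = go (locate val v)
      where
      P↭ : P ↭ D ∷ (map whole Us ++ Un′)
      P↭ = ↭-trans (++⁺ˡ (map whole Us) p) (shift D (map whole Us) Un′)
      n₃′ = λ m → n₃ (∈-++⁺ʳ (cs T) m)
      n₄′ = λ m → n₄ (∈-++⁺ʳ (cs T) m)
      go : Place (Hs ++ T) W P Z (u ∷ Y) v → _
      go (inY m) = ⊥-elim (v∉ (∈-++⁺ʳ (map a Hs) (∈-++⁺ʳ (vs T) m)))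
      go (inZ m) = released-Z e (here refl) X (∉-resp P↭ n₃′) m (reorder ↭-refl ↭-refl P↭ val)
      go (inW m) = let W′ , q = ∈⇒↭ m in
        released-free e (here refl) X (∉-resp P↭ n₃′) (∉-resp P↭ n₄′) (reorder ↭-refl q P↭ val)
      go (inP m) with ∈-++⁻ (vc D) (∈-resp-↭ (vp-↭ P↭) m)
      ... | inj₁ v∈ = released-own e (here refl) X (∉-resp P↭ n₃′) (∉-resp P↭ n₄′) v∈ (reorder ↭-refl ↭-refl P↭ val)
      ... | inj₂ m = let D′ , P′ , q , v∈ = findComp (map whole Us ++ Un′) m
                         P↭′ = ↭-trans P↭ (_↭_.prep D q) in
        released-block e (here refl) X (∉-resp P↭′ n₃′) v∈ (reorder ↭-refl ↭-refl P↭′ val)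
      go (inS m) with ∈-++⁻ (vs Hs) (∈-resp-↭ (vs-++↭ Hs T) m)
      ... | inj₂ m = ⊥-elim (v∉ (∈-++⁺ʳ (map a Hs) (∈-++⁺ˡ m)))
      ... | inj₁ m with endpoint Hs m
      ... | inj₁ (_ , m , refl) = ⊥-elim (v∉ (∈-++⁺ˡ (∈-map-a m)))
      ... | inj₂ (_ , m , refl) = let S′ , rest , val′ = rebased m in
        released-free e (here refl) X (∉-resp p (shrink n₃′)) (∉-resp p (shrink n₄′)) (reorder ↭-refl ↭-refl p val′)

    stuck : ∀ {p₀} → Step (length κ) p₀
    stuck with find u (cs T ++ ip (map whole Us) ++ κ) (map a Hs ++ vs T ++ u ∷ Y) (δ u) few
    ... | v , d , e , d∉ , v∉ with d ∈ℕ? ip Un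
    ... | yes m with findIdx Un m
    ... | D , Un′ , p , refl = released p e v∉
    stuck | v , d , e , d∉ , v∉ | no d∉Un = plain e
      (λ m → [ (λ m → [ (λ m → d∉ (∈-++⁺ʳ (cs T) (∈-++⁺ˡ m))) , d∉Un ]′
            (∈-++⁻ (ip (map whole Us)) (∈-resp-↭ (ip-++ (map whole Us) Un) m)))
        , (λ m → d∉ (∈-++⁺ʳ (cs T) (∈-++⁺ʳ (ip (map whole Us)) m))) ]′ (∈-++⁻ (ip P) m)) v∉

  module _ {Hs T : List Edge} {W Z Y : List V} {κ : List ℕ} (Us : List Used) (Un : List Comp)
    (val : Valid (Hs ++ T) W (map whole Us ++ Un) Z Y κ) (promoted : length Hs ≡ length W + length Us) where

    private
      budget′ : 3 * (length Hs + length T) + 11 ≤ (length Us + length Un) + 2 * length W + η Y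
      budget′ = subst₂ _≤_ (cong (λ z → 3 * z + 11) (length-++ Hs))
              (cong (λ z → z + 2 * length W + η Y) (trans (length-++ (map whole Us)) (cong (_+ length Un)
                  (length-map whole Us))))
              (budget val)

    many-unused : 2 * length T + 5 ≤ length Un
    many-unused = arith (length Hs) (length T) (length Us) (length Un) (length W) (η Y) (η≤1 Y) promoted budget′
      where
      arith : ∀ h t u n w y → y ≤ 1 → h ≡ w + u → 3 * (h + t) + 11 ≤ (u + n) + 2 * w + y → 2 * t + 5 ≤ n
      arith h t u n w y y≤ refl q = +-cancelˡ-≤ (u + 2 * w + 1) _ _ (begin
        u + 2 * w + 1 + (2 * t + 5)             ≤⟨ m≤m+n _ (2 * u + w + t + 5) ⟩
        u + 2 * w + 1 + (2 * t + 5) + (2 * u + w + t + 5) ≡⟨ l₁ t u w ⟩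
        3 * (w + u + t) + 11                    ≤⟨ q ⟩
        (u + n) + 2 * w + y                     ≤⟨ +-monoʳ-≤ ((u + n) + 2 * w) y≤ ⟩
        (u + n) + 2 * w + 1                     ≡⟨ l₂ u n w ⟩
        u + 2 * w + 1 + n                       ∎)
        where
        open ≤-Reasoning
        l₁ : ∀ t u w → u + 2 * w + 1 + (2 * t + 5) + (2 * u + w + t + 5) ≡ 3 * (w + u + t) + 11
        l₁ = solve-∀
        l₂ : ∀ u n w → (u + n) + 2 * w + 1 ≡ u + 2 * w + 1 + n
        l₂ = solve-∀

    few-bad : length (cs T ++ ip (map whole Us) ++ κ) + length (map a Hs ++ vs T ++ Y) < k
    few-bad = subst₂ _<_ (sym bad) (size val) (s≤s (≤-trans
      (arith (length Hs) (length T) (length Us) (length Un) (length κ) (length Y) many-unused (small val))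
          (≤-reflexive (sym all))))
      where
      bad : length (cs T ++ ip (map whole Us) ++ κ) + length (map a Hs ++ vs T ++ Y) ≡
        (length T + (length Us + length κ)) + (length Hs + ((length T + length T) + length Y))
      bad = cong₂ _+_
        (trans (length-++ (cs T)) (cong₂ _+_ (length-map c T) (trans (length-++ (ip (map whole Us)))
          (cong (_+ length κ) (trans (length-map idx (map whole Us)) (length-map whole Us))))))
        (trans (length-++ (map a Hs)) (cong₂ _+_ (length-map a Hs) (trans (length-++ (vs T)) (cong
            (_+ length Y) (length-vs T)))))
      all : length (cs (Hs ++ T) ++ ip (map whole Us ++ Un) ++ κ) ≡ (length Hs + length T) +
          ((length Us + length Un) + length κ)
      all = trans (length-++ (cs (Hs ++ T))) (cong₂ _+_ (trans (length-map c (Hs ++ T)) (length-++ Hs))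
        (trans (length-++ (ip (map whole Us ++ Un))) (cong (_+ length κ) (trans (length-map idx (map whole Us ++ Un))
          (trans (length-++ (map whole Us)) (cong (_+ length Un) (length-map whole Us)))))))
      arith : ∀ h t u n κ y → 2 * t + 5 ≤ n → y ≤ 4 →
        (t + (u + κ)) + (h + ((t + t) + y)) ≤ (h + t) + ((u + n) + κ)
      arith h t u n κ y q y≤ = begin
        (t + (u + κ)) + (h + ((t + t) + y))  ≤⟨ +-monoʳ-≤ (t + (u + κ)) (+-monoʳ-≤ h (+-monoʳ-≤ (t + t)
            (≤-trans y≤ (n≤1+n 4)))) ⟩
        (t + (u + κ)) + (h + ((t + t) + 5))  ≡⟨ l h t u κ ⟩
        (h + t) + ((u + (2 * t + 5)) + κ)    ≤⟨ +-monoʳ-≤ (h + t) (+-monoˡ-≤ κ (+-monoʳ-≤ u q)) ⟩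
        (h + t) + ((u + n) + κ)              ∎
        where
        open ≤-Reasoning
        l : ∀ h t u κ → (t + (u + κ)) + (h + ((t + t) + 5)) ≡ (h + t) + ((u + (2 * t + 5)) + κ)
        l = solve-∀

  -- The phases of promotion.

  reserve : ∀ {S W D P Z κ p₀} → Valid S W (D ∷ P) Z [] κ → Step (length κ) p₀
  -- The stuck case searches from a vertex of `Y`, so `D` is moved there; `η` makes up for its loss
  -- from the pool.
  reserve {D = D} {Z = Z} val = κ↑ (config (grow {Es = []} {ws = []} {D ∷ []} {A = Z} {vc D} val
    (solve 2 (λ z d → z ⊕ d ⊜ (d ⊕ id) ⊕ (z ⊕ id)) ↭-refl Z (vc D)) r (r (keep ↭-refl)) ≤-refl ≤-refl)) ≤-refl
    where r = robust-pair (robust-resp (++-identityʳ Z) ↭-refl (join (rob val))) (robust-comp D)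

  stuckStep : ∀ {Hs T W Z Y κ U src p₀} Us Un →
    Valid (Hs ++ T) W (map whole Us ++ Un) Z Y κ → src ↭ W ++ map unit Us →
    cs (Hs ++ T) ++ ip (map whole Us ++ Un) ++ κ ↭ U → All (Freeable U Hs src) Hs →
    length Hs ≡ length W + length Us →
    (∀ {D} → D ∈ Un → ∃ λ (X : Crossed D) →
      c (e₃ X) ∉ cs T ++ ip (map whole Us ++ Un) ++ κ × c (e₄ X) ∉ cs T ++ ip (map whole Us ++ Un) ++ κ) →
    Step (length κ) p₀
  stuckStep {Hs} {T} {Y = u ∷ Y} Us Un val sources colours fs promoted crossing =
    Stuck.stuck Us Un val sources colours fs (few-bad {Hs} {T} Us Un val promoted) crossing
  stuckStep {Y = []} Us (D ∷ Un) val _ _ _ _ _ = reserve (reorder ↭-refl ↭-refl (shift D (map whole Us) Un) val)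
  stuckStep {Hs} {T} {Y = []} Us [] val _ _ _ promoted _ with ≤-trans (m≤n+m 5 (2 * length T))
      (many-unused {Hs} {T} Us [] val promoted)
  ... | ()

  -- An admissible edge at the `unit` of an uncrossed component gives a step unless it ends in `T`,
  -- where it promotes another edge. The bound `m` drives the recursion, as `orient` rearranges `T`.
  unitPhase : ∀ {Hs W Z Y κ U src p₀} m T → length T ≤ m → ∀ Us Un →
    Valid (Hs ++ T) W (map whole Us ++ Un) Z Y κ → src ↭ W ++ map unit Us →
    cs (Hs ++ T) ++ ip (map whole Us ++ Un) ++ κ ↭ U → All (Freeable U Hs src) Hs →
    length Hs ≡ length W + length Us → Step (length κ) p₀
  unitPhase {Hs} {W} {Z} {Y} {κ} {U} {src} {p₀} m T T≤ Us Un val sources colours fs promoted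
    with classifyAll (cs T ++ ip (map whole Us ++ Un) ++ κ) Un
      (λ D∈ → ∈-++⁺ʳ (cs T) (∈-++⁺ˡ (∈-map⁺ idx (∈-++⁺ʳ (map whole Us) D∈))))
  ... | inj₂ crossing = stuckStep Us Un val sources colours fs promoted crossing
  ... | inj₁ (N , Un′ , p , clean)
    with find (unit N) (cs T ++ ip (map whole Us ++ Un) ++ κ) (map a Hs) (δ (unit N)) (room {Hs} {T} val)
  ... | v , d , e , d∉ , v∉ = go (locate val v)
    where
    P = map whole Us ++ Un
    D = whole N
    P↭ : P ↭ D ∷ (map whole Us ++ Un′)
    P↭ = ↭-trans (++⁺ˡ (map whole Us) p) (shift D (map whole Us) Un′)
    d∉′ : d ∉ ip P ++ κ
    d∉′ m = d∉ (∈-++⁺ʳ (cs T) m)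
    u∈ : unit N ∈ vc D
    u∈ = ∈-resp-↭ (↭-sym (apart N)) (here refl)
    shrink : d ∉ ip Un ++ κ
    shrink m = d∉′ ([ (λ m → ∈-++⁺ˡ (∈-resp-↭ (↭-sym (ip-++ (map whole Us) Un)) (∈-++⁺ʳ (ip (map whole Us)) m)))
        , ∈-++⁺ʳ (ip P) ]′ (∈-++⁻ (ip Un) m))
    advance : ∀ m → length T ≤ m → v ∈ vs T → Step (length κ) p₀
    advance zero T≤0 v∈ = ⊥-elim (none T T≤0 v∈)
      where
      none : ∀ T → length T ≤ 0 → v ∉ vs T
      none [] _ ()
    advance (suc m) T≤ v∈ with orient T v∈
    ... | g , T′ , refl , pv , pc = unitPhase {Hs = g ∷ Hs} m T′
      (s≤s⁻¹ (≤-trans (≤-reflexive (trans (sym (length-map c (g ∷ T′))) (trans (sym (↭-length pc))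
          (length-map c T)))) T≤))
      (N ∷ Us) Un′ (valid-resp {S = Hs ++ T} {g ∷ Hs ++ T′} (move-vs {Hs} {T} {g} {T′} pv pc)
          (move-cs {Hs} {T} {g} {T′} pv pc) ↭-refl P↭ val)
      (↭-trans (_↭_.prep (unit N) sources) (↭-sym (shift (unit N) W (map unit Us))))
      (↭-trans (++⁺ (↭-sym (move-cs {Hs} {T} {g} {T′} pv pc)) (++⁺ʳ κ (map⁺ idx (↭-sym P↭)))) colours)
      (promote e fs (occupied {Hs} {T} {P = P} colours d∉))
      (trans (cong suc promoted) (sym (+-suc (length W) (length Us))))
    go : Place (Hs ++ T) W P Z Y v → Step (length κ) p₀
    go (inY m) = block-Y e (inComp u∈) m (reorder ↭-refl ↭-refl P↭ val) (s≤s z≤n) (∉-resp P↭ d∉′)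
    go (inZ m) = block-Z e (inComp u∈) m (reorder ↭-refl ↭-refl P↭ val) (s≤s z≤n) (∉-resp P↭ d∉′)
    go (inW m) = let W′ , q = ∈⇒↭ m in
      block-block e (inComp u∈) (single v) (reorder ↭-refl q P↭ val) ≤-refl (∉-resp P↭ d∉′)
    go (inP m) with ∈-++⁻ (vc D) (∈-resp-↭ (vp-↭ P↭) m)
    ... | inj₁ v∈ = ⊥-elim (clean v∈ (d , e , d∉))
    ... | inj₂ m = let D′ , P′ , q , v∈ = findComp (map whole Us ++ Un′) m
                       P↭′ = ↭-trans P↭ (_↭_.prep D q) in
      block-block e (inComp u∈) (inComp v∈) (reorder ↭-refl ↭-refl P↭′ val) (s≤s (s≤s z≤n)) (∉-resp P↭′ d∉′)
    go (inS m₀) with ∈-++⁻ (vs Hs) (∈-resp-↭ (vs-++↭ Hs T) m₀)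
    ... | inj₂ m₁ = advance m T≤ m₁
    ... | inj₁ m₁ with endpoint Hs m₁
    ... | inj₁ (_ , m₂ , refl) = ⊥-elim (v∉ (∈-map-a m₂))
    ... | inj₂ (_ , m₂ , refl) =
      let S′ , rest , val′ = rebase Us Un val (↭-trans (++-identityʳ src) sources) colours (All.lookup fs m₂) in
      block-block e (inComp u∈) (single v) (reorder ↭-refl ↭-refl p val′) ≤-refl (∉-resp p shrink)

  -- Each free vertex gives a step or becomes the source of one promotion. Once all are sources, the
  -- components take over.
  freePhase : ∀ {Hs T P Z Y κ U src} todo → Valid (Hs ++ T) (todo ++ src) P Z Y κ →
    cs (Hs ++ T) ++ ip P ++ κ ↭ U → All (Freeable U Hs src) Hs → length Hs ≡ length src →
    Step (length κ) (length P)
  freePhase {T = T} {P} {src = src} [] val colours fs promoted =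
    unitPhase (length T) T ≤-refl [] P val (↭-sym (++-identityʳ src)) colours fs
      (trans promoted (sym (+-identityʳ (length src))))
  freePhase {Hs} {T} {P} {Z} {Y} {κ} {U} {src} (w ∷ todo) val colours fs promoted
    with find w (cs T ++ ip P ++ κ) (map a Hs) (δ w) (room {Hs} {T} val)
  ... | v , d , e , d∉ , v∉ = go (locate val v)
    where
    d∉′ : d ∉ ip P ++ κ
    d∉′ m = d∉ (∈-++⁺ʳ (cs T) m)
    go : Place (Hs ++ T) (w ∷ todo ++ src) P Z Y v → Step (length κ) (length P)
    go (inY m) = block-Y e (single w) m val ≤-refl d∉′
    go (inZ m) = block-Z e (single w) m val (s≤s (s≤s z≤n)) d∉′
    go (inW (here refl)) = ⊥-elim (no-loop e)
    go (inW (there m)) = let W′ , p = ∈⇒↭ m in free-free e (reorder ↭-refl (_↭_.prep w p) ↭-refl val) d∉′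
    go (inP m) = let D , P′ , p , v∈ = findComp P m in
      block-block e (single w) (inComp v∈) (reorder ↭-refl ↭-refl p val) ≤-refl (∉-resp p d∉′)
    go (inS m) with ∈-++⁻ (vs Hs) (∈-resp-↭ (vs-++↭ Hs T) m)
    ... | inj₁ m₁ with endpoint Hs m₁
    ... | inj₁ (_ , m₂ , refl) = ⊥-elim (v∉ (∈-map-a m₂))
    -- `w` is not yet a source, so the exchange leaves it free and `e` joins two free vertices.
    ... | inj₂ (_ , m₂ , refl) =
      let S′ , rest , val′ = rebase [] P val
            (↭-trans (++-comm src (w ∷ todo)) (↭-sym (++-identityʳ (w ∷ todo ++ src)))) colours (All.lookup fs m₂) in
      free-free e (reorder ↭-refl (solve 4 (λ b r w t → b ⊕ (r ⊕ ((w ⊕ t) ⊕ id)) ⊜ w ⊕ (b ⊕ (r ⊕ t))) ↭-refl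
        (v ∷ []) rest (w ∷ []) todo) ↭-refl val′) d∉′
    go (inS m) | inj₂ m₁ with orient T m₁
    ... | g , T′ , refl , pv , pc = freePhase {Hs = g ∷ Hs} {T′} todo
      (valid-resp {S = Hs ++ T} {g ∷ Hs ++ T′} (move-vs {Hs} {T} {g} {T′} pv pc) (move-cs {Hs} {T} {g} {T′} pv pc)
        (↭-sym (shift w todo src)) ↭-refl val)
      (↭-trans (++⁺ʳ (ip P ++ κ) (↭-sym (move-cs {Hs} {T} {g} {T′} pv pc))) colours)
      (promote e fs (occupied {Hs} {T} {P = P} colours d∉)) (cong suc promoted)

  -- Iteration.

  step : ∀ {S W P Z Y κ} → Valid S W P Z Y κ → Step (length κ) (length P)
  step {S} {W} {P} {Z} {Y} {κ} val = freePhase {[]} {S} W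
    (reorder ↭-refl (↭-sym (++-identityʳ W)) ↭-refl val) ↭-refl [] refl

  -- `x` and `y` bound the remaining growth of `κ` and of the pool. Both lengths stay below `k` by
  -- `size`, so neither bound can be exceeded; a growth of `κ` resets `y`.
  iterate : ∀ x y (C : Config) → k ≤ x + length (Config.κ C) → k ≤ y + length (Config.P C) → Goal
  iterate x y C x≤ y≤ with step (Config.valid C)
  ... | goal g = g
  iterate zero y (config {S} {P = P} {κ = κ} val) x≤ y≤ | κ↑ _ _ = ⊥-elim (<⇒≱ (≤-reflexive (size val)) (≤-trans x≤
    (≤-trans (m≤n+m (length κ) (length (ip P))) (≤-trans (≤-reflexive (sym (length-++ (ip P))))
    (≤-trans (m≤n+m (length (ip P ++ κ)) (length (cs S))) (≤-reflexive (sym (length-++ (cs S)))))))))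
  iterate (suc x) y C x≤ y≤ | κ↑ C′ lt = iterate x k C′
    (≤-trans x≤ (≤-trans (≤-reflexive (sym (+-suc x _))) (+-monoʳ-≤ x lt))) (m≤m+n k _)
  iterate x zero (config {S} {P = P} {κ = κ} val) x≤ y≤ | P↑ _ _ _ = ⊥-elim (<⇒≱ (≤-reflexive (size val)) (≤-trans y≤
    (≤-trans (≤-reflexive (sym (length-map idx P))) (≤-trans (m≤m+n (length (ip P)) (length κ)) (≤-trans
        (≤-reflexive (sym (length-++ (ip P))))
    (≤-trans (m≤n+m (length (ip P ++ κ)) (length (cs S))) (≤-reflexive (sym (length-++ (cs S))))))))))
  iterate x (suc y) C x≤ y≤ | P↑ C′ eq lt = iterate x y C′
    (≤-trans x≤ (≤-reflexive (cong (x +_) eq)))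
    (≤-trans y≤ (≤-trans (≤-reflexive (sym (+-suc y _))) (+-monoʳ-≤ y lt)))

  augment : 7 * k + 4 ≤ 2 * n → ∀ {K} → allFin n ⊩ K → Unique K → suc (length K) ≡ k → Goal
  augment large {K} (supply es rest p q) u l = iterate k k (config {es} {rest} {[]} {[]} {[]} {[]} (record
    { part = ↭-trans (++⁺ˡ (vs es) (++-identityʳ rest)) (↭-sym p)
    ; uniq = uniq-resp (↭-trans (↭-sym q) (↭-sym (++-identityʳ (cs es)))) u
    ; size = trans (cong suc (trans (↭-length (++-identityʳ (cs es))) (↭-length q))) l
    ; rob = λ _ _ → ⊩-[]
    ; small = z≤n
    -- With `k` - 1 edges in `S` and all other vertices free, the budget is exactly the bound on
    -- `n`.
    ; budget = arith (length es) (length rest) n k (sym (trans (cong suc (trans (sym (length-map c es))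
        (↭-length q))) l))
        (trans (sym (length-tabulate {n = n} (λ i → i))) (trans (↭-length p) (trans (length-++ (vs es)) (cong
            (_+ length rest) (length-vs es))))) large
    })) (m≤m+n k 0) (m≤m+n k 0)
    where
    arith : ∀ e r n k → k ≡ suc e → n ≡ e + e + r → 7 * k + 4 ≤ 2 * n → 3 * e + 11 ≤ 0 + 2 * r + 0
    arith e r _ _ refl refl q = +-cancelˡ-≤ (4 * e) _ _ (≤-trans (≤-reflexive (l₁ e)) (≤-trans q (≤-reflexive
        (l₂ e r))))
      where
      l₁ : ∀ e → 4 * e + (3 * e + 11) ≡ 7 * suc e + 4
      l₁ = solve-∀
      l₂ : ∀ e r → 2 * (e + e + r) ≡ 4 * e + (0 + 2 * r + 0)
      l₂ = solve-∀

-- Reading off the rainbow matching.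

module _ {n : ℕ} (G : ColouredGraph n) where
  open Graph G

  endpoints-∈ : ∀ E i → a (lookup E i) ∈ vs E × b (lookup E i) ∈ vs E
  endpoints-∈ (e ∷ E) Fin.zero = here refl , there (here refl)
  endpoints-∈ (e ∷ E) (Fin.suc i) = let p , q = endpoints-∈ E i in there (there p) , there (there q)

  separate : ∀ E → Unique (vs E) → ∀ i j → i ≢ j →
    a (lookup E i) ≢ a (lookup E j) × b (lookup E i) ≢ b (lookup E j) × a (lookup E i) ≢ b (lookup E j)
  separate (e ∷ E) u Fin.zero Fin.zero i≢j = ⊥-elim (i≢j refl)
  separate (e ∷ E) ((_ ∷ x) ∷ y ∷ u) Fin.zero (Fin.suc j) _ = let p , q = endpoints-∈ E j in
    All.lookup x p , All.lookup y q , All.lookup x q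
  separate (e ∷ E) ((_ ∷ x) ∷ y ∷ u) (Fin.suc i) Fin.zero _ = let p , q = endpoints-∈ E i in
    (λ r → All.lookup x p (sym r)) , (λ r → All.lookup y q (sym r)) , (λ r → All.lookup y p (sym r))
  separate (e ∷ E) (_ ∷ _ ∷ u) (Fin.suc i) (Fin.suc j) i≢j = separate E u i j (λ r → i≢j (cong Fin.suc r))

  ends-differ : ∀ E → Unique (vs E) → ∀ i → a (lookup E i) ≢ b (lookup E i)
  ends-differ (e ∷ E) ((x ∷ _) ∷ _) Fin.zero = x
  ends-differ (e ∷ E) (_ ∷ _ ∷ u) (Fin.suc i) = ends-differ E u i

  colours-differ : ∀ E → Unique (cs E) → ∀ i j → i ≢ j → c (lookup E i) ≢ c (lookup E j)
  colours-differ (e ∷ E) u Fin.zero Fin.zero i≢j = ⊥-elim (i≢j refl)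
  colours-differ (e ∷ E) (x ∷ u) Fin.zero (Fin.suc j) _ = All.lookup x (∈-map⁺ c (∈-lookup j))
  colours-differ (e ∷ E) (x ∷ u) (Fin.suc i) Fin.zero _ r = All.lookup x (∈-map⁺ c (∈-lookup i)) (sym r)
  colours-differ (e ∷ E) (_ ∷ u) (Fin.suc i) (Fin.suc j) i≢j = colours-differ E u i j (λ r → i≢j (cong Fin.suc r))

  rainbow : ∀ {k K} → allFin n ⊩ K → Unique K → length K ≡ k → RainbowMatching G k
  rainbow {K = K} (supply E rest p q) uK refl = subst (RainbowMatching G) (trans (sym (length-map c E))
      (↭-length q)) record
    { a = λ i → a (lookup E i)
    ; b = λ i → b (lookup E i)
    ; c = λ i → c (lookup E i)
    ; isEdge = λ i → isE (lookup E i)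
    ; disjAA = λ i j ne → proj₁ (separate E uE i j ne)
    ; disjBB = λ i j ne → proj₁ (proj₂ (separate E uE i j ne))
    ; disjAB = apart
    ; rainbow = colours-differ E (uniq-resp (↭-sym q) uK)
    }
    where
    uE : Unique (vs E)
    uE = uniq-prefix (vs E) (uniq-resp p (allFin⁺ n))
    apart : ∀ i j → a (lookup E i) ≢ b (lookup E j)
    apart i j with i Fin.≟ j
    ... | yes refl = ends-differ E uE i
    ... | no ne = proj₂ (proj₂ (separate E uE i j ne))

theorem1p1 : (k n : ℕ) → (G : ColouredGraph n) → 7 * k + 4 ≤ 2 * n →
    MinColourDegree≥ G k → RainbowMatching G k
theorem1p1 k n G large δ = let _ , s , u , l = build k ≤-refl in rainbow G s u l
  where
  open Graph G
  -- The hypotheses for `k` imply those for every smaller size, so the matching grows from the empty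
  -- one edge at a time.
  build : ∀ j → j ≤ k → ∃ λ K → allFin n ⊩ K × Unique K × length K ≡ j
  build zero _ = [] , ⊩-[] , [] , refl
  build (suc j) j<k = let _ , s , u , l = build j (<⇒≤ j<k) in
    Search.augment G (suc j) (λ v → ≤-trans j<k (δ v))
      (≤-trans (+-monoˡ-≤ 4 (*-monoʳ-≤ 7 j<k)) large) s u (cong suc l)
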